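{- Let $M$ be an algebraic number field of degree $m$ with ring of integers $\mathbb{Z}_M$ and integral basis $(1,\omega_2,\ldots,\omega_m)$. Let $\alpha$ be an algebraic integer over $M$ of degree $n$ over $M$, let $K=M(\alpha)$, and let $0\neq\mu\in\mathbb{Z}_M$. Define \[ c_{hji}=\tfrac12\left|\alpha^{(hj)}-\alpha^{(hi)}\right|\quad(1\le h\le m,\ 1\le i,j\le n,\ i\ne j), \qquad c_{hi}=\frac{|\mu^{(h)}|}{\prod_{1\le j\le n,\,j\ne i}c_{hji}}\quad(1\le h\le m,\ 1\le i\le n), \] \[ c_1=\max_{h,j,i}\frac{\sqrt[n]{|\mu^{(h)}|}}{c_{hji}}\ \ (\text{max over }1\le h\le m,\ 1\le i,j\le n,\ i\ne j),\qquad c_3=\frac{\sqrt[n]{\overline{|\mu|}}}{\overline{|\alpha|}},\qquad c_4=\max(c_1,c_3), \] \[ c_5=2c_2\,\overline{|\alpha|},\qquad d_{hi}=c_{hi}\,c_5^{\,n-1}\quad(1\le h\le m,\ 1\le i\le n), \] where $c_2$ is the row norm of $S^{ -1}$ (the maximum over the rows of $S^{ -1}$ of the sum of absolute values of the entries in that row), $S$ being the $m\times m$ matrix whose $j$-th row is $(1,\omega_2^{(j)},\ldots,\omega_m^{(j)})$. Suppose $X,Y\in\mathbb{Z}_M$ satisfy $N_{K/M}(X-\alpha Y)=\mu$ and $\overline{|Y|}>c_4$. Write $X=x_1+\omega_2x_2+\cdots+\omega_mx_m$, $Y=y_1+\omega_2y_2+\cdots+\omega_my_m$ with $x_i,y_i\in\mathbb{Z}$,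 put $A=\max(\max_i|x_i|,\max_i|y_i|)$ and $\beta=X-\alpha Y$. Then there exist indices $h,i$ with $1\le h\le m$, $1\le i\le n$ such that \[ |\beta^{(hi)}|\le d_{hi}\,A^{1-n}. \]
   Context: Let $\sigma_1,\ldots,\sigma_m$ be the embeddings of $M$ into $\mathbb{C}$; for $\gamma\in M$ write $\gamma^{(j)}=\sigma_j(\gamma)$. Let $f(x)$ be the monic relative defining polynomial of $\alpha$ over $M$, and for $j=1,\ldots,m$ let $\alpha^{(j1)},\ldots,\alpha^{(jn)}$ be the roots of the polynomial obtained by applying $\sigma_j$ to the coefficients of $f$. For $\gamma\in K$, $\gamma^{(jk)}$ denotes the image of $\gamma$ under the embedding of $K$ into $\mathbb{C}$ extending $\sigma_j$ and sending $\alpha$ to $\alpha^{(jk)}$; thus $\beta^{(hi)}=X^{(h)}-\alpha^{(hi)}Y^{(h)}$. For an algebraic number $\gamma$, its size $\overline{|\gamma|}$ is the maximum of the absolute values of its conjugates; in particular $\overline{|\alpha|}=\max_{j,k}|\alpha^{(jk)}|$, $\overline{|Y|}=\max_j|Y^{(j)}|$, $\overline{|\mu|}=\max_j|\mu^{(j)}|$. It is assumed that the $\alpha^{(hj)}$, $1\le j\le n$, are pairwise distinct for each $h$ (as they are, $f$ being irreducible over $M$), so that all $c_{hji}>0$. -}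

module Defs where

open import Algebra.Apartness.Bundles using (HeytingField; HeytingCommutativeRing)
open import Algebra.Bundles using (CommutativeRing; RawRing)
open import Algebra.Morphism.Structures using (module RingMorphisms)
open import Data.Fin.Base using (Fin; zero; suc; toℕ; punchIn)
open import Data.Fin.Properties using (_≟_)
open import Data.Integer.Base as ℤ using (ℤ; +_; -[1+_])
open import Data.Nat.Base as ℕ using (ℕ; zero; suc; NonZero)
open import Data.Product.Base using (∃; ∃₂; _×_; _,_; proj₁; proj₂)
open import Data.Product.Relation.Binary.Pointwise.NonDependent using (Pointwise)
open import Data.Rational.Base as ℚ using (ℚ)
open import Data.Sum.Base using (inj₁; inj₂)
open import Data.Vec.Functional using (Vector; foldr)
open import Level using (Level; _⊔_) renaming (suc to lsuc)
open import Relation.Binary.Bundles using (DecTotalOrder)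
open import Relation.Binary.Core using (Rel)
open import Relation.Binary.PropositionalEquality.Core using (_≡_)
open import Relation.Binary.Structures using (IsDecTotalOrder)
open import Relation.Nullary using (¬_; yes; no; does)
open import Relation.Unary using (Pred; Satisfiable)
open import Data.Bool.Base using (if_then_else_)
import Algebra.Construct.NaturalChoice.Max as Max
import Algebra.Definitions.RawSemiring as RawSemiringDefs
import Algebra.Properties.Ring as RingProperties
import Relation.Binary.Construct.NonStrictToStrict as Strict
import Relation.Binary.Reasoning.PartialOrder as PosetReasoning

Matrix : ∀ {a} → Set a → ℕ → Set a
Matrix A n = Fin n → Fin n → A

allExcept : ∀ {a} {A : Set a} {n} → A → Fin n → Vector A n → Vector A n
allExcept d i x j = if does (j ≟ i) then d else x j

maxℕ : ∀ {n} → Vector ℕ n → ℕ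
maxℕ = foldr ℕ._⊔_ 0

module RawRingDefs {c ℓ} (R : RawRing c ℓ) where
  open RawRing R
  open RawSemiringDefs rawSemiring public using (_^_; sum; product)
  open RawSemiringDefs rawSemiring using () renaming (_×_ to _·_)

  fromℕ : ℕ → Carrier
  fromℕ n = n · 1#

  fromℤ : ℤ → Carrier
  fromℤ (+ n)    = fromℕ n
  fromℤ -[1+ n ] = - fromℕ (suc n)

  powers : ∀ n → Carrier → Vector Carrier n
  powers n x i = x ^ toℕ i

  -- The value at x of X ^ n + a₍ₙ₋₁₎ X ^ (n - 1) + ⋯ + a₀.
  evalMonic : ∀ {n} → Vector Carrier n → Carrier → Carrier
  evalMonic {n} a x = x ^ n + sum (λ i → a i * powers n x i)

  IsIntegral : Carrier → Set ℓ
  IsIntegral x = ∃₂ λ d (a : Vector ℤ d) → evalMonic (λ i → fromℤ (a i)) x ≈ 0#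

  det : ∀ {n} → Matrix Carrier n → Carrier
  det {zero}  A = 1#
  det {suc n} A = sum λ j →
    (- 1#) ^ toℕ j * (A zero j * det (λ i k → A (suc i) (punchIn j k)))

  1ᴹ : ∀ {n} → Matrix Carrier n
  1ᴹ i j = if does (i ≟ j) then 1# else 0#

  _*ᴹ_ : ∀ {n} → Matrix Carrier n → Matrix Carrier n → Matrix Carrier n
  (A *ᴹ B) i k = sum λ j → A i j * B j k

  IsInverse : ∀ {n} → Matrix Carrier n → Matrix Carrier n → Set ℓ
  IsInverse A B = (∀ i j → (A *ᴹ B) i j ≈ 1ᴹ i j) × (∀ i j → (B *ᴹ A) i j ≈ 1ᴹ i j)

module ExtensionDefs {f ℓ₁ e ℓ₂} (F : RawRing f ℓ₁) (E : RawRing e ℓ₂)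
                     (ι : RawRing.Carrier F → RawRing.Carrier E) where
  private
    module F = RawRing F
  open RawRing E
  open RawRingDefs E
  open RawRingDefs F using () renaming (det to detF)

  combination : ∀ {n} → Vector Carrier n → Vector F.Carrier n → Carrier
  combination e c = sum (λ i → ι (c i) * e i)

  IsIndependent : ∀ {n} → Vector Carrier n → Set (f ⊔ ℓ₁ ⊔ ℓ₂)
  IsIndependent {n} e = ∀ (c : Vector F.Carrier n) → combination e c ≈ 0# → ∀ i → c i F.≈ F.0#

  IsBasis : ∀ {n} → Vector Carrier n → Set (f ⊔ ℓ₁ ⊔ e ⊔ ℓ₂)
  IsBasis e = (∀ x → ∃ λ c → x ≈ combination e c) × IsIndependent e

  -- x ↦ γ * x is F-linear on E, and L is its matrix with respect to the
  -- basis e (row i: coordinates of γ * e i); the norm of γ is the determinant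
  -- of this map.
  IsNorm : ∀ {n} → Vector Carrier n → Carrier → F.Carrier → Set (f ⊔ ℓ₁ ⊔ ℓ₂)
  IsNorm {n} e γ ν = ∃ λ (L : Matrix F.Carrier n) →
    (∀ i → γ * e i ≈ combination e (L i)) × detF L F.≈ ν

  -- The polynomial is monic of degree n with lower coefficients a.
  -- Independence of the powers of α says that no nonzero polynomial of
  -- degree less than n vanishes at α.
  record IsMinimalPolynomial {n} (α : Carrier) (a : Vector F.Carrier n)
         : Set (f ⊔ ℓ₁ ⊔ ℓ₂) where
    field
      root    : evalMonic (λ i → ι (a i)) α ≈ 0#
      minimal : IsIndependent (powers n α)

module Field {c ℓ₁ ℓ₂} (F : HeytingField c ℓ₁ ℓ₂) where
  open HeytingField F public using (_#_; heytingCommutativeRing; #⇒invertible)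
  commutativeRing : CommutativeRing c ℓ₁
  commutativeRing = HeytingCommutativeRing.commutativeRing heytingCommutativeRing
  open CommutativeRing commutativeRing public
  open RawRingDefs rawRing public

module _ {c ℓ₁ ℓ₂ c′ ℓ₁′ ℓ₂′} (F : HeytingField c ℓ₁ ℓ₂) (E : HeytingField c′ ℓ₁′ ℓ₂′)
         (ι : HeytingField.Carrier F → HeytingField.Carrier E) where
  private
    module F = HeytingField F
    module E = HeytingField E

  -- F(α): the smallest subfield of E containing the image of F and α.
  data Adjoin (α : E.Carrier) : E.Carrier → Set (c ⊔ c′ ⊔ ℓ₁′) where
    base : ∀ x → Adjoin α (ι x)
    gen  : Adjoin α α
    add  : ∀ {x y} → Adjoin α x → Adjoin α y → Adjoin α (x E.+ y)
    neg  : ∀ {x} → Adjoin α x → Adjoin α (E.- x)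
    mul  : ∀ {x y} → Adjoin α x → Adjoin α y → Adjoin α (x E.* y)
    inv  : ∀ {x y} → x E.* y E.≈ E.1# → Adjoin α x → Adjoin α y
    resp : ∀ {x y} → x E.≈ y → Adjoin α x → Adjoin α y

IsHom : ∀ {a ℓ₁ b ℓ₂} (R : RawRing a ℓ₁) (S : RawRing b ℓ₂) →
        (RawRing.Carrier R → RawRing.Carrier S) → Set (a ⊔ ℓ₁ ⊔ ℓ₂)
IsHom R S = RingMorphisms.IsRingHomomorphism R S

record NumberField c ℓ₁ ℓ₂ (m : ℕ) : Set (lsuc (c ⊔ ℓ₁ ⊔ ℓ₂)) where
  field
    heytingField : HeytingField c ℓ₁ ℓ₂
  open Field heytingField public
  field
    fromℚ   : ℚ → Carrier
    isHom   : IsHom ℚ.+-*-rawRing rawRing fromℚ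
    basis   : Vector Carrier m
    isBasis : ExtensionDefs.IsBasis ℚ.+-*-rawRing rawRing fromℚ basis

  open ExtensionDefs ℤ.+-*-rawRing rawRing fromℤ public
    using () renaming (combination to ℤ-combination; IsIndependent to ℤ-IsIndependent)

  record IsIntegralBasis (ω : Vector Carrier m) : Set (c ⊔ ℓ₁) where
    field
      integral    : ∀ i → IsIntegral (ω i)
      spanning    : ∀ x → IsIntegral x → ∃ λ c → x ≈ ℤ-combination ω c
      independent : ℤ-IsIndependent ω
      first       : ∀ i → toℕ i ≡ 0 → ω i ≈ 1#

-- A Dedekind-complete totally ordered field.  Classically there is exactly
-- one up to isomorphism, namely ℝ.
record CompleteOrderedField r ℓ₁ ℓ₂ ℓ₃ : Set (lsuc (r ⊔ ℓ₁ ⊔ ℓ₂ ⊔ ℓ₃)) where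
  infix 4 _≤_
  field
    heytingField : HeytingField r ℓ₁ ℓ₂
  open Field heytingField public
  field
    ≉⇒#             : ∀ {x y} → ¬ (x ≈ y) → x # y
    _≤_             : Rel Carrier ℓ₃
    isDecTotalOrder : IsDecTotalOrder _≈_ _≤_
    +-monoʳ-≤       : ∀ x {y z} → y ≤ z → x + y ≤ x + z
    *-nonNeg        : ∀ {x y} → 0# ≤ x → 0# ≤ y → 0# ≤ x * y

  IsUpperBound : Pred Carrier ℓ₃ → Carrier → Set (r ⊔ ℓ₃)
  IsUpperBound P u = ∀ {x} → P x → x ≤ u

  field
    supremum : (P : Pred Carrier ℓ₃) → Satisfiable P → ∃ (IsUpperBound P) →
               ∃ λ s → IsUpperBound P s × (∀ u → IsUpperBound P u → s ≤ u)

  decTotalOrder : DecTotalOrder r ℓ₁ ℓ₃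
  decTotalOrder = record { isDecTotalOrder = isDecTotalOrder }

  open DecTotalOrder decTotalOrder public
    using (totalOrder; poset; total; antisym)
    renaming (_≟_ to _≈?_; refl to ≤-refl; trans to ≤-trans; reflexive to ≤-reflexive)
  open Max totalOrder public renaming (_⊔_ to _⊔ᴿ_) using (x≤y⊔x)
  open Strict _≈_ _≤_ public using (_<_)

module Reals {r ℓ₁ ℓ₂ ℓ₃} (ℝ : CompleteOrderedField r ℓ₁ ℓ₂ ℓ₃) where
  open CompleteOrderedField ℝ
  open RingProperties ring using (-‿distribˡ-*; -‿distribʳ-*; -‿involutive)
  open PosetReasoning poset

  infix  9 _⁻¹
  infixr 8 _^ℤ_

  -- Total, with 0# ⁻¹ = 0#.
  _⁻¹ : Carrier → Carrier
  x ⁻¹ with x ≈? 0#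
  ... | yes _  = 0#
  ... | no x≉0 = proj₁ (#⇒invertible (≉⇒# x≉0))

  _^ℤ_ : Carrier → ℤ → Carrier
  x ^ℤ (+ n)    = x ^ n
  x ^ℤ -[1+ n ] = (x ⁻¹) ^ suc n

  -- Maximum of a family of nonnegative reals; 0# for the empty family.
  maximum : ∀ {n} → Vector Carrier n → Carrier
  maximum = foldr _⊔ᴿ_ 0#

  0≤maximum : ∀ {n} (x : Vector Carrier n) → 0# ≤ maximum x
  0≤maximum {zero}  x = ≤-refl
  0≤maximum {suc n} x = ≤-trans (0≤maximum (λ i → x (suc i))) (x≤y⊔x _ _)

  -‿anti-0 : ∀ {x} → x ≤ 0# → 0# ≤ - x
  -‿anti-0 {x} x≤0 = begin
    0#       ≈⟨ -‿inverseˡ x ⟨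
    - x + x  ≤⟨ +-monoʳ-≤ (- x) x≤0 ⟩
    - x + 0# ≈⟨ +-identityʳ (- x) ⟩
    - x      ∎

  0≤x*x : ∀ x → 0# ≤ x * x
  0≤x*x x with total 0# x
  ... | inj₁ 0≤x = *-nonNeg 0≤x 0≤x
  ... | inj₂ x≤0 = begin
    0#            ≤⟨ *-nonNeg (-‿anti-0 x≤0) (-‿anti-0 x≤0) ⟩
    (- x) * (- x) ≈⟨ -‿distribˡ-* x (- x) ⟨
    - (x * - x)   ≈⟨ -‿cong (-‿distribʳ-* x x) ⟨
    - - (x * x)   ≈⟨ -‿involutive (x * x) ⟩
    x * x         ∎

  0≤1 : 0# ≤ 1#
  0≤1 = ≤-trans (0≤x*x 1#) (≤-reflexive (*-identityˡ 1#))

  0≤x+y : ∀ {x y} → 0# ≤ x → 0# ≤ y → 0# ≤ x + y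
  0≤x+y {x} {y} 0≤x 0≤y = begin
    0#     ≤⟨ 0≤x ⟩
    x      ≈⟨ +-identityʳ x ⟨
    x + 0# ≤⟨ +-monoʳ-≤ x 0≤y ⟩
    x + y  ∎

  *-monoˡ-≤ : ∀ {x y z} → 0# ≤ z → x ≤ y → x * z ≤ y * z
  *-monoˡ-≤ {x} {y} {z} 0≤z x≤y = begin
    x * z                   ≈⟨ +-identityʳ (x * z) ⟨
    x * z + 0#              ≤⟨ +-monoʳ-≤ (x * z) (*-nonNeg 0≤y-x 0≤z) ⟩
    x * z + (y - x) * z     ≈⟨ distribʳ z x (y - x) ⟨
    (x + (y - x)) * z       ≈⟨ *-congʳ (+-comm x (y - x)) ⟩
    (y - x + x) * z         ≈⟨ *-congʳ (+-assoc y (- x) x) ⟩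
    (y + (- x + x)) * z     ≈⟨ *-congʳ (+-congˡ (-‿inverseˡ x)) ⟩
    (y + 0#) * z            ≈⟨ *-congʳ (+-identityʳ y) ⟩
    y * z                   ∎
    where
    0≤y-x : 0# ≤ y - x
    0≤y-x = begin
      0#      ≈⟨ -‿inverseˡ x ⟨
      - x + x ≤⟨ +-monoʳ-≤ (- x) x≤y ⟩
      - x + y ≈⟨ +-comm (- x) y ⟩
      y - x   ∎

  1≤x^n : ∀ {x} n → 1# ≤ x → 1# ≤ x ^ n
  1≤x^n zero    1≤x = ≤-refl
  1≤x^n {x} (suc n) 1≤x = begin
    1#      ≤⟨ 1≤x^n n 1≤x ⟩
    x ^ n   ≈⟨ *-identityˡ (x ^ n) ⟨
    1# * x ^ n ≤⟨ *-monoˡ-≤ (≤-trans 0≤1 (1≤x^n n 1≤x)) 1≤x ⟩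
    x * x ^ n ∎

  module _ (n : ℕ) .{{_ : NonZero n}} (x : Carrier) (0≤x : 0# ≤ x) where

    RootBelow : Pred Carrier ℓ₃
    RootBelow y = 0# ≤ y × y ^ n ≤ x

    0-RootBelow : RootBelow 0#
    0-RootBelow = ≤-refl , 0^n≤x n
      where
      0^n≤x : ∀ n .{{_ : NonZero n}} → 0# ^ n ≤ x
      0^n≤x (suc n) = ≤-trans (≤-reflexive (zeroˡ (0# ^ n))) 0≤x

    RootBelow-bounded : IsUpperBound RootBelow (1# + x)
    RootBelow-bounded {y} (0≤y , y^n≤x) = go n y^n≤x
      where
      x≤1+x : x ≤ 1# + x
      x≤1+x = begin
        x      ≈⟨ +-identityʳ x ⟨
        x + 0# ≤⟨ +-monoʳ-≤ x 0≤1 ⟩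
        x + 1# ≈⟨ +-comm x 1# ⟩
        1# + x ∎

      1≤1+x : 1# ≤ 1# + x
      1≤1+x = begin
        1#      ≈⟨ +-identityʳ 1# ⟨
        1# + 0# ≤⟨ +-monoʳ-≤ 1# 0≤x ⟩
        1# + x  ∎

      go : ∀ n .{{_ : NonZero n}} → y ^ n ≤ x → y ≤ 1# + x
      go (suc n) y^n≤x with total y (1# + x)
      ... | inj₁ y≤1+x = y≤1+x
      ... | inj₂ 1+x≤y = begin
        y          ≈⟨ *-identityˡ y ⟨
        1# * y     ≤⟨ *-monoˡ-≤ 0≤y (1≤x^n n (≤-trans 1≤1+x 1+x≤y)) ⟩
        y ^ n * y  ≈⟨ *-comm (y ^ n) y ⟩
        y * y ^ n  ≤⟨ y^n≤x ⟩
        x          ≤⟨ x≤1+x ⟩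
        1# + x     ∎

    private
      root-sup = supremum RootBelow (0# , 0-RootBelow) (1# + x , RootBelow-bounded)

    -- The nonnegative n-th root of x, as sup { y ≥ 0 | y ^ n ≤ x }.
    root : Carrier
    root = proj₁ root-sup

    0≤root : 0# ≤ root
    0≤root = proj₁ (proj₂ root-sup) 0-RootBelow

  ℂ : RawRing r ℓ₁
  ℂ = record
    { Carrier = Carrier × Carrier
    ; _≈_     = Pointwise _≈_ _≈_
    ; _+_     = λ { (a , b) (c , d) → a + c , b + d }
    ; _*_     = λ { (a , b) (c , d) → a * c - b * d , a * d + b * c }
    ; -_      = λ { (a , b) → - a , - b }
    ; 0#      = 0# , 0#
    ; 1#      = 1# , 0#
    }

  open RawRing ℂ public using ()
    renaming ( Carrier to Complex; _≈_ to _≈ᶜ_; _+_ to _+ᶜ_; -_ to -ᶜ_; 0# to 0ᶜ )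

  private
    0≤normSq : ∀ (z : Complex) → 0# ≤ proj₁ z * proj₁ z + proj₂ z * proj₂ z
    0≤normSq z = 0≤x+y (0≤x*x (proj₁ z)) (0≤x*x (proj₂ z))

  ∣_∣ : Complex → Carrier
  ∣ z ∣ = root 2 (proj₁ z * proj₁ z + proj₂ z * proj₂ z) (0≤normSq z)

  0≤∣_∣ : ∀ z → 0# ≤ ∣ z ∣
  0≤∣ z ∣ = 0≤root 2 _ (0≤normSq z)

  size : ∀ {m} → Vector Complex m → Carrier
  size z = maximum (λ j → ∣ z j ∣)

  rowNorm : ∀ {m} → Matrix Complex m → Carrier
  rowNorm T = maximum (λ i → sum (λ j → ∣ T i j ∣))

  -- σ lists all embeddings of F into ℂ, each exactly once.
  record IsEmbeddings {c ℓ} (F : RawRing c ℓ) {m}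
         (σ : Fin m → RawRing.Carrier F → Complex) : Set (c ⊔ ℓ ⊔ r ⊔ ℓ₁) where
    field
      isHom    : ∀ j → IsHom F ℂ (σ j)
      distinct : ∀ i j → (∀ x → σ i x ≈ᶜ σ j x) → i ≡ j
      complete : ∀ φ → IsHom F ℂ φ → ∃ λ j → ∀ x → φ x ≈ᶜ σ j x

  -- z lists all roots of the monic polynomial with lower coefficients a,
  -- each exactly once.
  record IsRoots {n} (a : Vector Complex n) (z : Vector Complex n) : Set (r ⊔ ℓ₁) where
    field
      isRoot   : ∀ k → RawRingDefs.evalMonic ℂ a (z k) ≈ᶜ 0ᶜ
      distinct : ∀ i k → z i ≈ᶜ z k → i ≡ k
      complete : ∀ w → RawRingDefs.evalMonic ℂ a w ≈ᶜ 0ᶜ → ∃ λ k → w ≈ᶜ z k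

  -- α h j and μ h are the conjugates of α and μ, and T = S⁻¹.  The index i is
  -- omitted from maxima and products over j.  When n = 1 the maximum c₁ is
  -- over no terms and equals 0#.
  module Constants {m n : ℕ} .{{_ : NonZero n}}
                   (α : Fin m → Vector Complex n) (μ : Vector Complex m)
                   (T : Matrix Complex m) where

    sizeα : Carrier
    sizeα = maximum (λ h → size (α h))

    c : Fin m → Fin n → Fin n → Carrier
    c h j i = fromℕ 2 ⁻¹ * ∣ α h j +ᶜ -ᶜ α h i ∣

    cᵢ : Fin m → Fin n → Carrier
    cᵢ h i = ∣ μ h ∣ * product (allExcept 1# i (λ j → c h j i)) ⁻¹

    c₁ : Carrier
    c₁ = maximum λ h → maximum λ i → maximum (allExcept 0# i λ j →
           root n ∣ μ h ∣ 0≤∣ μ h ∣ * c h j i ⁻¹)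

    c₂ : Carrier
    c₂ = rowNorm T

    c₃ : Carrier
    c₃ = root n (size μ) (0≤maximum (λ h → ∣ μ h ∣)) * sizeα ⁻¹

    c₄ : Carrier
    c₄ = c₁ ⊔ᴿ c₃

    c₅ : Carrier
    c₅ = fromℕ 2 * c₂ * sizeα

    d : Fin m → Fin n → Carrier
    d h i = cᵢ h i * c₅ ^ (n ℕ.∸ 1)

{-# OPTIONS --safe #-}

-- Let h maximize |Y^(h)| and let i minimize |β^(hi)|. Since ∏ⱼ |β^(hj)| = |μ^(h)|,
-- |β^(hi)| is at most the n-th root of |μ^(h)|, so |Y^(h)| > c₁ and
-- β^(hi) - β^(hj) = (α^(hj) - α^(hi)) Y^(h) give |β^(hj)| ≥ c_hji |Y^(h)| for j ≠ i; dividing the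
-- product formula by these factors bounds |β^(hi)| by c_hi |Y^(h)|^(1-n). Inverting S
-- and using |Y| > c₃ to bound |X| by 2|α||Y| gives A ≤ c₅ |Y^(h)|; for the
-- coordinates of Y this needs 2|α| ≥ 1.
--
-- The product formula: by uniqueness of coordinates, multiplication by X - αY has
-- matrix X I - Y C with C the companion matrix of f, so its determinant is the
-- homogenization of f, which splits over ℂ.
--
-- The bound 2|α| ≥ 1 for n ≥ 2: otherwise the constant term of f, an algebraic integer
-- as a product of such, has size at most 1/2; its powers have integral coordinates
-- tending to 0, so it vanishes, and hence α = 0.
module Submission where

open import Defs
open import Algebra.Apartness.Bundles using (HeytingField; HeytingCommutativeRing)
import Algebra.Apartness.Properties.HeytingCommutativeRing as HeytingProperties
open import Algebra.Bundles using (CommutativeRing; RawRing)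
import Algebra.Construct.NaturalChoice.Max as Max
open import Algebra.Morphism.Structures using (module RingMorphisms)
import Algebra.Properties.AbelianGroup as AbelianGroupProperties
import Algebra.Properties.CommutativeSemiring.Exp as CommutativeExp
import Algebra.Properties.Ring as RingProperties
import Algebra.Properties.Semiring.Exp as Exp
import Algebra.Properties.Semiring.Mult as Mult
import Algebra.Properties.Semiring.Sum as Sum
import Algebra.Solver.Ring as RingSolver
open import Algebra.Solver.Ring.AlmostCommutativeRing
  using (fromCommutativeRing; _-Raw-AlmostCommutative⟶_)
open import Algebra.Structures using (IsCommutativeRing)
open import Data.Fin.Base as Fin using (Fin; zero; suc; toℕ; inject₁; punchIn; _↑ˡ_; _↑ʳ_; combine; remQuot)
import Data.Fin.Properties as Fin
open import Data.Fin.Relation.Unary.Top using (view; ‵fromℕ; ‵inject₁)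
open import Data.Integer.Base as ℤ using (ℤ; +_; -[1+_])
import Data.Integer.Properties as ℤ
open import Data.Maybe.Base using (just; nothing)
open import Data.Nat.Base as ℕ using (ℕ; zero; suc; NonZero)
import Data.Nat.Properties as ℕ
open import Data.Product.Base using (∃; ∃₂; _×_; _,_; proj₁; proj₂)
open import Data.Sum.Base using (inj₁; inj₂)
open import Data.Vec.Functional using (Vector; tail; _∷_)
open import Function.Base using (_∘_)
open import Level using (_⊔_)
open import Relation.Binary.PropositionalEquality.Core as ≡ using (_≡_; _≢_)
import Relation.Binary.Reasoning.PartialOrder as PosetReasoning
open import Relation.Nullary using (¬_; yes; no; contradiction)
open import Relation.Nullary.Decidable.Core using (decidable-stable)

-- The exponent 1 - n is not positive, so passing from |Y|^(1-n) to A^(1-n) takes an upper bound for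
-- A, and A involves the coordinates of both X and Y. For X the constant c₃ provides it at every
-- conjugate h: the smallest |β^(hi)| is at most the n-th root of the size of μ, hence at most
-- |α||Y|, and X = β + αY. For Y the bound 2|α||Y| is a statement about α alone, and there the
-- integrality of α enters: a nonzero algebraic integer cannot have all conjugates of absolute value
-- at most 1/2. In degree 1, α may be 0, but then the exponent is 0 and both sides of the comparison
-- are 1. Products of algebraic integers are shown integral by elimination on a matrix of
-- polynomials in γ, in place of a characteristic polynomial. The only determinant evaluated is that
-- of X I - Y C, by induction along its first row.

-- The map from the integers to a commutative ring, and a ring solver with integer coefficients.

module IntegerCoefficients {c ℓ} (R : CommutativeRing c ℓ) where
  open CommutativeRing R hiding (zero)
  open RawRingDefs rawRing
  open import Relation.Binary.Reasoning.Setoid setoid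
  open RingProperties ring using (-‿distribˡ-*; -‿distribʳ-*; -‿involutive; -0#≈0#)
  open AbelianGroupProperties +-abelianGroup using (⁻¹-∙-comm; xyx⁻¹≈y)
  open Mult semiring using (×-homo-+; ×1-homo-*)

  fromℤ-⊖ : ∀ m n → fromℤ (m ℤ.⊖ n) ≈ fromℕ m - fromℕ n
  fromℤ-⊖ m       zero    = sym (trans (+-congˡ -0#≈0#) (+-identityʳ _))
  fromℤ-⊖ zero    (suc n) = sym (+-identityˡ _)
  fromℤ-⊖ (suc m) (suc n) = begin
    fromℤ (suc m ℤ.⊖ suc n)                ≡⟨ ≡.cong fromℤ (ℤ.[1+m]⊖[1+n]≡m⊖n m n) ⟩
    fromℤ (m ℤ.⊖ n)                        ≈⟨ fromℤ-⊖ m n ⟩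
    fromℕ m - fromℕ n                      ≈⟨ xyx⁻¹≈y 1# _ ⟨
    1# + (fromℕ m - fromℕ n) - 1#          ≈⟨ +-congʳ (+-assoc _ _ _) ⟨
    1# + fromℕ m - fromℕ n - 1#            ≈⟨ +-assoc _ _ _ ⟩
    1# + fromℕ m + (- fromℕ n - 1#)        ≈⟨ +-congˡ (+-comm _ _) ⟩
    1# + fromℕ m + (- 1# - fromℕ n)        ≈⟨ +-congˡ (⁻¹-∙-comm _ _) ⟩
    1# + fromℕ m - (1# + fromℕ n)          ∎

  fromℤ-homo-- : ∀ i → fromℤ (ℤ.- i) ≈ - fromℤ i
  fromℤ-homo-- (+ zero)  = sym -0#≈0#
  fromℤ-homo-- (+ suc n) = refl
  fromℤ-homo-- -[1+ n ]  = sym (-‿involutive _)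

  fromℤ-homo-+ : ∀ i j → fromℤ (i ℤ.+ j) ≈ fromℤ i + fromℤ j
  fromℤ-homo-+ (+ m)    (+ n)    = ×-homo-+ 1# m n
  fromℤ-homo-+ (+ m)    -[1+ n ] = fromℤ-⊖ m (suc n)
  fromℤ-homo-+ -[1+ m ] (+ n)    = trans (fromℤ-⊖ n (suc m)) (+-comm _ _)
  fromℤ-homo-+ -[1+ m ] -[1+ n ] = begin
    - (1# + (1# + fromℕ (m ℕ.+ n)))         ≈⟨ -‿cong (+-congˡ (+-congˡ (×-homo-+ 1# m n))) ⟩
    - (1# + (1# + (fromℕ m + fromℕ n)))     ≈⟨ -‿cong (+-congˡ (trans (sym (+-assoc _ _ _)) (trans (+-congʳ (+-comm _ _)) (+-assoc _ _ _)))) ⟩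
    - (1# + (fromℕ m + (1# + fromℕ n)))     ≈⟨ -‿cong (+-assoc _ _ _) ⟨
    - (1# + fromℕ m + (1# + fromℕ n))       ≈⟨ ⁻¹-∙-comm _ _ ⟨
    - (1# + fromℕ m) - (1# + fromℕ n)       ∎

  fromℤ-homo-* : ∀ i j → fromℤ (i ℤ.* j) ≈ fromℤ i * fromℤ j
  fromℤ-homo-* (+ m)    (+ n)    = trans (reflexive (≡.cong fromℤ (ℤ.+◃n≡+n (m ℕ.* n)))) (×1-homo-* m n)
  fromℤ-homo-* (+ m)    -[1+ n ] = begin
    fromℤ (+ m ℤ.* -[1+ n ])        ≡⟨ ≡.cong fromℤ (ℤ.-◃n≡-n (m ℕ.* suc n)) ⟩
    fromℤ (ℤ.- + (m ℕ.* suc n))     ≈⟨ fromℤ-homo-- (+ (m ℕ.* suc n)) ⟩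
    - fromℕ (m ℕ.* suc n)           ≈⟨ -‿cong (×1-homo-* m (suc n)) ⟩
    - (fromℕ m * fromℕ (suc n))     ≈⟨ -‿distribʳ-* _ _ ⟩
    fromℕ m * - fromℕ (suc n)       ∎
  fromℤ-homo-* -[1+ m ] (+ n)    = begin
    fromℤ (-[1+ m ] ℤ.* + n)        ≡⟨ ≡.cong fromℤ (ℤ.-◃n≡-n (suc m ℕ.* n)) ⟩
    fromℤ (ℤ.- + (suc m ℕ.* n))     ≈⟨ fromℤ-homo-- (+ (suc m ℕ.* n)) ⟩
    - fromℕ (suc m ℕ.* n)           ≈⟨ -‿cong (×1-homo-* (suc m) n) ⟩
    - (fromℕ (suc m) * fromℕ n)     ≈⟨ -‿distribˡ-* _ _ ⟩
    - fromℕ (suc m) * fromℕ n       ∎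
  fromℤ-homo-* -[1+ m ] -[1+ n ] = begin
    fromℕ (suc m ℕ.* suc n)           ≈⟨ ×1-homo-* (suc m) (suc n) ⟩
    fromℕ (suc m) * fromℕ (suc n)     ≈⟨ -‿involutive _ ⟨
    - - (fromℕ (suc m) * fromℕ (suc n)) ≈⟨ -‿cong (-‿distribˡ-* _ _) ⟩
    - (- fromℕ (suc m) * fromℕ (suc n)) ≈⟨ -‿distribʳ-* _ _ ⟩
    - fromℕ (suc m) * - fromℕ (suc n) ∎

  -- Agrees with fromℤ, but sends the constants 0 and 1 of the solver to 0# and 1# on the nose.
  constant : ℤ → Carrier
  constant (+ 0) = 0#
  constant (+ 1) = 1#
  constant i     = fromℤ i

  constant≈fromℤ : ∀ i → constant i ≈ fromℤ i
  constant≈fromℤ (+ 0)           = refl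
  constant≈fromℤ (+ 1)           = sym (+-identityʳ 1#)
  constant≈fromℤ (+ suc (suc n)) = refl
  constant≈fromℤ -[1+ n ]        = refl

  constant-homomorphism : ℤ.+-*-rawRing -Raw-AlmostCommutative⟶ fromCommutativeRing R
  constant-homomorphism = record
    { ⟦_⟧    = constant
    ; +-homo = λ i j → trans (constant≈fromℤ (i ℤ.+ j)) (trans (fromℤ-homo-+ i j)
                 (sym (+-cong (constant≈fromℤ i) (constant≈fromℤ j))))
    ; *-homo = λ i j → trans (constant≈fromℤ (i ℤ.* j)) (trans (fromℤ-homo-* i j)
                 (sym (*-cong (constant≈fromℤ i) (constant≈fromℤ j))))
    ; -‿homo = λ i → trans (constant≈fromℤ (ℤ.- i)) (trans (fromℤ-homo-- i)
                 (sym (-‿cong (constant≈fromℤ i))))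
    ; 0-homo = refl
    ; 1-homo = refl
    }

  private
    _coefficient≟_ : ∀ i j → _
    i coefficient≟ j with i ℤ.≟ j
    ... | yes i≡j = just (reflexive (≡.cong constant i≡j))
    ... | no  _   = nothing

  open RingSolver ℤ.+-*-rawRing (fromCommutativeRing R) constant-homomorphism _coefficient≟_ public
    using (solve; con; _:=_; _:+_; _:*_; _:-_; :-_)

-- Finite sums and products, identity matrices, values of monic polynomials.

module RingLemmas {c ℓ} (R : CommutativeRing c ℓ) where
  open CommutativeRing R hiding (zero)
  open RawRingDefs rawRing
  open IntegerCoefficients R
  open import Relation.Binary.Reasoning.Setoid setoid
  open Sum semiring using (sum-cong-≋; sum-replicate-zero; *-distribˡ-sum)
  open Exp semiring using (^-congˡ)

  sum-cong : ∀ n {x y : Vector Carrier n} → (∀ i → x i ≈ y i) → sum x ≈ sum y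
  sum-cong n = sum-cong-≋

  linear-difference : ∀ x a y b → (x - a * y) - (x - b * y) ≈ (b - a) * y
  linear-difference = solve 4 (λ x a y b → (x :- a :* y) :- (x :- b :* y) := (b :- a) :* y) refl

  x≈x-y+y : ∀ x y → x ≈ (x - y) + y
  x≈x-y+y = solve 2 (λ x y → x := (x :- y) :+ y) refl

  1^n≈1 : ∀ n → 1# ^ n ≈ 1#
  1^n≈1 zero    = refl
  1^n≈1 (suc n) = trans (*-identityˡ _) (1^n≈1 n)

  sum-zero : ∀ n (x : Vector Carrier n) → (∀ i → x i ≈ 0#) → sum x ≈ 0#
  sum-zero n x x≈0 = trans (sum-cong n x≈0) (sum-replicate-zero n)

  product-cong : ∀ n {x y : Vector Carrier n} → (∀ i → x i ≈ y i) → product x ≈ product y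
  product-cong zero x≈y = refl
  product-cong (suc n) x≈y = *-cong (x≈y zero) (product-cong n (x≈y ∘ suc))

  1ᴹ-sum : ∀ {n} (i : Fin n) (x : Vector Carrier n) → sum (λ j → 1ᴹ i j * x j) ≈ x i
  1ᴹ-sum {suc n} zero x = trans (+-cong (*-identityˡ _) (sum-zero n _ λ j → zeroˡ (x (suc j)))) (+-identityʳ _)
  1ᴹ-sum (suc i)      x = trans (+-cong (zeroˡ _) (1ᴹ-sum i (x ∘ suc))) (+-identityˡ _)

  det-cong : ∀ n {A B : Matrix Carrier n} → (∀ i j → A i j ≈ B i j) → det A ≈ det B
  det-cong zero A≈B = refl
  det-cong (suc n) A≈B = sum-cong (suc n) λ j →
    *-congˡ {(- 1#) ^ toℕ j} (*-cong (A≈B zero j) (det-cong n λ i k → A≈B (suc i) (punchIn j k)))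

  evalMonic-cong : ∀ n {a b : Vector Carrier n} {x y} →
                   (∀ i → a i ≈ b i) → x ≈ y → evalMonic a x ≈ evalMonic b y
  evalMonic-cong n a≈b x≈y =
    +-cong (^-congˡ n x≈y) (sum-cong n λ i → *-cong (a≈b i) (^-congˡ (toℕ i) x≈y))

  -- Peels off the constant term, which is the recursion on which `Value`, `form`, `quotient` and
  -- `multiplication` are built.
  sum-powers-horner : ∀ n (a : Vector Carrier (suc n)) x →
    sum (λ i → a i * powers (suc n) x i) ≈ a zero + x * sum (λ i → tail a i * powers n x i)
  sum-powers-horner n a x = +-cong (*-identityʳ _) (begin
    sum (λ i → tail a i * (x * powers n x i))  ≈⟨ sum-cong n (λ i → swap (tail a i) x (powers n x i)) ⟩
    sum (λ i → x * (tail a i * powers n x i))  ≈⟨ *-distribˡ-sum {n} x _ ⟨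
    x * sum (λ i → tail a i * powers n x i)    ∎)
    where
    swap = solve 3 (λ a x p → a :* (x :* p) := x :* (a :* p)) refl

  horner : ∀ n (a : Vector Carrier (suc n)) x →
           evalMonic a x ≈ a zero + x * evalMonic (tail a) x
  horner n a x = begin
    x * x ^ n + sum (λ i → a i * powers (suc n) x i)                       ≈⟨ +-congˡ (sum-powers-horner n a x) ⟩
    x * x ^ n + (a zero + x * sum (λ i → tail a i * powers n x i))         ≈⟨ regroup x (x ^ n) (a zero) _ ⟩
    a zero + x * evalMonic (tail a) x                                      ∎
    where
    regroup = solve 4 (λ x p a s → x :* p :+ (a :+ x :* s) := a :+ x :* (p :+ s)) refl

-- Ring homomorphisms, polynomial values and integrality.

module HomomorphismLemmas {c₁ ℓ₁ c₂ ℓ₂} (R : CommutativeRing c₁ ℓ₁) (S : CommutativeRing c₂ ℓ₂)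
  {φ : CommutativeRing.Carrier R → CommutativeRing.Carrier S}
  (φ-isHom : IsHom (CommutativeRing.rawRing R) (CommutativeRing.rawRing S) φ) where
  private
    module R where
      open CommutativeRing R public hiding (zero)
      open RawRingDefs rawRing public
  open CommutativeRing S hiding (zero)
  open RawRingDefs rawRing
  open RingLemmas S using (sum-cong; evalMonic-cong)
  open RingMorphisms.IsRingHomomorphism φ-isHom

  fromℕ-homo : ∀ n → φ (R.fromℕ n) ≈ fromℕ n
  fromℕ-homo zero    = 0#-homo
  fromℕ-homo (suc n) = trans (+-homo _ _) (+-cong 1#-homo (fromℕ-homo n))

  fromℤ-homo : ∀ i → φ (R.fromℤ i) ≈ fromℤ i
  fromℤ-homo (+ n)    = fromℕ-homo n
  fromℤ-homo -[1+ n ] = trans (-‿homo _) (-‿cong (fromℕ-homo (suc n)))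

  1ᴹ-homo : ∀ {n} (i j : Fin n) → φ (R.1ᴹ i j) ≈ 1ᴹ i j
  1ᴹ-homo i j with i Fin.≟ j
  ... | yes _ = 1#-homo
  ... | no  _ = 0#-homo

  sum-homo : ∀ n (x : Vector R.Carrier n) → φ (R.sum x) ≈ sum (φ ∘ x)
  sum-homo zero x = 0#-homo
  sum-homo (suc n) x = trans (+-homo _ _) (+-congˡ (sum-homo n (x ∘ suc)))

  ^-homo : ∀ x n → φ (x R.^ n) ≈ φ x ^ n
  ^-homo x zero    = 1#-homo
  ^-homo x (suc n) = trans (*-homo _ _) (*-congˡ (^-homo x n))

  evalMonic-homo : ∀ n (a : Vector R.Carrier n) x → φ (R.evalMonic a x) ≈ evalMonic (φ ∘ a) (φ x)
  evalMonic-homo n a x = trans (+-homo _ _) (+-cong (^-homo x n) (trans (sum-homo n _)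
    (sum-cong n λ i → trans (*-homo (a i) _) (*-congˡ (^-homo x (toℕ i))))))

  ℤ-combination-homo : ∀ n (e : Vector R.Carrier n) (z : Vector ℤ n) →
    φ (R.sum (λ i → R.fromℤ (z i) R.* e i)) ≈ sum (λ i → fromℤ (z i) * φ (e i))
  ℤ-combination-homo n e z = trans (sum-homo n _)
    (sum-cong n λ i → trans (*-homo _ (e i)) (*-congʳ (fromℤ-homo (z i))))

  integral-homo : ∀ {x} → R.IsIntegral x → IsIntegral (φ x)
  integral-homo {x} (d , a , eq) = d , a ,
    trans (evalMonic-cong d (λ i → sym (fromℤ-homo (a i))) refl)
      (trans (sym (evalMonic-homo d _ x)) (trans (⟦⟧-cong eq) 0#-homo))

  -- The same integer polynomial serves on both sides. This carries integrality from ℂ, where the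
  -- conjugates of α can be multiplied, back to `M`.
  integral-reflect : (∀ {y} → φ y ≈ 0# → y R.≈ R.0#) → ∀ {x} → IsIntegral (φ x) → R.IsIntegral x
  integral-reflect injective {x} (d , a , eq) = d , a ,
    injective (trans (evalMonic-homo d _ x)
      (trans (evalMonic-cong d (λ i → fromℤ-homo (a i)) refl) eq))

-- Algebraic integers are closed under products.

module Integrality {c ℓ} (R : CommutativeRing c ℓ) where
  open CommutativeRing R hiding (zero)
  open RawRingDefs rawRing
  open IntegerCoefficients R
  open RingLemmas R
  open import Relation.Binary.Reasoning.Setoid setoid
  open Sum semiring using (∑-distrib-+; *-distribˡ-sum; *-distribʳ-sum)

  -- Integer-valued, because it is the matrix of leading coefficients of γ I - L, and `Value` is
  -- indexed by an integer.
  δ : ∀ {n} → Matrix ℤ n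
  δ = RawRingDefs.1ᴹ ℤ.+-*-rawRing

  fromℤ-δ : ∀ {n} (i j : Fin n) → fromℤ (δ i j) ≈ 1ᴹ i j
  fromℤ-δ i j with i Fin.≟ j
  ... | yes _ = +-identityʳ 1#
  ... | no  _ = refl

  module _ (γ : Carrier) where

    -- Value t e x: x = g(γ) for an integer polynomial g of degree at most e
    -- whose coefficient of degree e is t.
    data Value (t : ℤ) : ℕ → Carrier → Set (c ⊔ ℓ) where
      base : ∀ {x} → x ≈ fromℤ t → Value t 0 x
      step     : ∀ {e x y} a → Value t e y → x ≈ fromℤ a + γ * y → Value t (suc e) x

    private
      variable
        s t : ℤ
        d e : ℕ
        x y : Carrier

    Value-resp : x ≈ y → Value t e x → Value t e y
    Value-resp x≈y (base eq) = base (trans (sym x≈y) eq)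
    Value-resp x≈y (step a v eq) = step a v (trans (sym x≈y) eq)

    Value-+ : Value s e x → Value t e y → Value (s ℤ.+ t) e (x + y)
    Value-+ {s} {t = t} (base x≈s) (base y≈t) =
      base (trans (+-cong x≈s y≈t) (sym (fromℤ-homo-+ s t)))
    Value-+ (step a u x≈) (step b v y≈) = step (a ℤ.+ b) (Value-+ u v)
      (trans (+-cong x≈ y≈) (trans (regroup _ _ _ _ γ) (+-congʳ (sym (fromℤ-homo-+ a b)))))
      where
      regroup = solve 5 (λ a b x y g → (a :+ g :* x) :+ (b :+ g :* y) := (a :+ b) :+ g :* (x :+ y)) refl

    Value-scale : ∀ b → Value t e x → Value (b ℤ.* t) e (fromℤ b * x)
    Value-scale {t} b (base x≈t) = base (trans (*-congˡ x≈t) (sym (fromℤ-homo-* b t)))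
    Value-scale b (step a v x≈) = step (b ℤ.* a) (Value-scale b v)
      (trans (*-congˡ x≈) (trans (regroup _ _ _ γ) (+-congʳ (sym (fromℤ-homo-* b a)))))
      where
      regroup = solve 4 (λ b a x g → b :* (a :+ g :* x) := b :* a :+ g :* (b :* x)) refl

    Value-shift : Value t e x → Value t (suc e) (γ * x)
    Value-shift v = step (+ 0) v (sym (+-identityˡ _))

    Value-0 : Value (+ 0) e 0#
    Value-0 {e = zero}  = base refl
    Value-0 {e = suc e} = Value-resp (zeroʳ γ) (Value-shift Value-0)

    -- `Value-+` adds only at equal nominal degree. Padding with a zero top coefficient brings a
    -- summand of lower degree up without disturbing the leading coefficient of the sum.
    Value-weaken : Value t e x → Value (+ 0) (suc e) x
    Value-weaken {t} (base x≈t) = step t (Value-0 {e = 0})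
      (trans x≈t (sym (trans (+-congˡ (zeroʳ γ)) (+-identityʳ _))))
    Value-weaken (step a v x≈) = step a (Value-weaken v) x≈

    Value-weaken-+ : ∀ d → Value t e x → Value (+ 0) (suc (d ℕ.+ e)) x
    Value-weaken-+ zero    v = Value-weaken v
    Value-weaken-+ (suc d) v = Value-weaken (Value-weaken-+ d v)

    Value-* : Value s d x → Value t e y → Value (s ℤ.* t) (d ℕ.+ e) (x * y)
    Value-* {s = s} (base x≈s) v = Value-resp (*-congʳ (sym x≈s)) (Value-scale s v)
    Value-* {s} {suc d} {t = t} {y = y} (step a u x≈) v =
      ≡.subst (λ z → Value z _ _) (ℤ.+-identityˡ (s ℤ.* t))
        (Value-resp (trans (regroup _ _ y γ) (*-congʳ (sym x≈)))
          (Value-+ (Value-weaken-+ d (Value-scale a v)) (Value-shift (Value-* u v))))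
      where
      regroup = solve 4 (λ a x y g → a :* y :+ g :* (x :* y) := (a :+ g :* x) :* y) refl

    Value⇒evalMonic : Value t e x → ∃ λ (a : Vector ℤ e) →
                      x ≈ fromℤ t * γ ^ e + sum (λ i → fromℤ (a i) * powers e γ i)
    Value⇒evalMonic (base x≈t) = (λ ()) , trans x≈t (sym (trans (+-identityʳ _) (*-identityʳ _)))
    Value⇒evalMonic {t} {suc e} {x} (step {y = y} b v x≈) with Value⇒evalMonic v
    ... | a , y≈ = b ∷ a , (begin
      x                                                                       ≈⟨ x≈ ⟩
      fromℤ b + γ * y                                                         ≈⟨ +-congˡ (*-congˡ y≈) ⟩
      fromℤ b + γ * (fromℤ t * γ ^ e + sum (λ i → fromℤ (a i) * powers e γ i)) ≈⟨ regroup (fromℤ b) γ (fromℤ t) (γ ^ e) _ ⟩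
      fromℤ t * (γ * γ ^ e) + (fromℤ b + γ * sum (λ i → fromℤ (a i) * powers e γ i)) ≈⟨ +-congˡ (sum-powers-horner e (fromℤ ∘ (b ∷ a)) γ) ⟨
      fromℤ t * γ ^ suc e + sum (λ i → fromℤ ((b ∷ a) i) * powers (suc e) γ i) ∎)
      where
      regroup = solve 5 (λ b g t p s → b :+ g :* (t :* p :+ s) := t :* (g :* p) :+ (b :+ g :* s)) refl

    Value-1⇒integral : Value (+ 1) e x → x ≈ 0# → IsIntegral γ
    Value-1⇒integral {e} v x≈0 with Value⇒evalMonic v
    ... | a , x≈ = e , a , trans (+-congʳ (sym (trans (*-congʳ (+-identityʳ 1#)) (*-identityˡ _))))
                             (trans (sym x≈) x≈0)

    -- Gaussian elimination without division: multiplying the rows below the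
    -- first by the pivot keeps diagonal entries monic of the common (doubled)
    -- degree and off-diagonal entries of smaller degree.
    eliminate : ∀ n {e} (A : Matrix Carrier n) (v : Vector Carrier n) →
                (∀ i j → Value (δ i j) e (A i j)) →
                (∀ i → sum (λ j → A i j * v j) ≈ 0#) →
                ∃₂ λ d p → Value (+ 1) d p × (∀ k → p * v k ≈ 0#)
    eliminate zero    A v val Av≈0 = 0 , fromℤ (+ 1) , base refl , λ ()
    eliminate (suc n) {e} A v val Av≈0 = extend (eliminate n B (v ∘ suc) B-val Bv≈0)
      where
      a = A zero zero

      B : Matrix Carrier n
      B i j = a * A (suc i) (suc j) + fromℤ -[1+ 0 ] * (A (suc i) zero * A zero (suc j))

      -- Both factors of the subtracted product lie off the diagonal, so its leading coefficient is
      -- 0; the other product contributes 1 times `δ i j`.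
      B-val : ∀ i j → Value (δ i j) (e ℕ.+ e) (B i j)
      B-val i j = ≡.subst (λ z → Value z _ (B i j))
        (≡.trans (ℤ.+-identityʳ _) (ℤ.*-identityˡ (δ i j)))
        (Value-+ (Value-* (val zero zero) (val (suc i) (suc j)))
                 (Value-scale -[1+ 0 ] (Value-* (val (suc i) zero) (val zero (suc j)))))

      row : Fin (suc n) → Carrier
      row i = sum (λ j → A i (suc j) * v (suc j))

      Bv≈0 : ∀ i → sum (λ j → B i j * v (suc j)) ≈ 0#
      Bv≈0 i = begin
        sum (λ j → B i j * v (suc j))
          ≈⟨ sum-cong n (λ j → expand a (A (suc i) (suc j)) (A (suc i) zero) (A zero (suc j)) (v (suc j))) ⟩
        sum (λ j → a * (A (suc i) (suc j) * v (suc j)) + m * (A zero (suc j) * v (suc j)))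
          ≈⟨ ∑-distrib-+ {n} _ _ ⟩
        sum (λ j → a * (A (suc i) (suc j) * v (suc j))) + sum (λ j → m * (A zero (suc j) * v (suc j)))
          ≈⟨ +-cong (*-distribˡ-sum {n} a _) (*-distribˡ-sum {n} m _) ⟨
        a * row (suc i) + m * row zero
          -- The terms in `v zero` inserted here cancel each other and complete both partial rows to
          -- full rows of A v.
          ≈⟨ regroup a (row (suc i)) (A (suc i) zero) (row zero) (v zero) ⟩
        a * (A (suc i) zero * v zero + row (suc i)) + m * (a * v zero + row zero)
          ≈⟨ +-cong (*-congˡ (Av≈0 (suc i))) (*-congˡ (Av≈0 zero)) ⟩
        a * 0# + m * 0#
          ≈⟨ trans (+-cong (zeroʳ a) (zeroʳ m)) (+-identityʳ 0#) ⟩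
        0# ∎
        where
        m = fromℤ -[1+ 0 ] * A (suc i) zero
        expand = solve 5 (λ a x y z v → (a :* x :+ con -[1+ 0 ] :* (y :* z)) :* v
                                        := a :* (x :* v) :+ (con -[1+ 0 ] :* y) :* (z :* v)) refl
        regroup = solve 5 (λ a s y r v → a :* s :+ (con -[1+ 0 ] :* y) :* r
                    := a :* (y :* v :+ s) :+ (con -[1+ 0 ] :* y) :* (a :* v :+ r)) refl

      extend : (∃₂ λ d p → Value (+ 1) d p × (∀ k → p * v (suc k) ≈ 0#)) →
               ∃₂ λ d p → Value (+ 1) d p × (∀ k → p * v k ≈ 0#)
      -- The factor `a` takes care of `v zero`: the first equation says a v₀ = - `row zero`, and `p`
      -- kills every term of `row zero`.
      extend (d , p , p-val , pv≈0) = d ℕ.+ e , p * a , Value-* p-val (val zero zero) , kills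
        where
        kills : ∀ k → p * a * v k ≈ 0#
        kills zero    = begin
          p * a * v zero                              ≈⟨ *-assoc p a _ ⟩
          p * (a * v zero)                            ≈⟨ +-identityʳ _ ⟨
          p * (a * v zero) + 0#                       ≈⟨ +-congˡ p*row≈0 ⟨
          p * (a * v zero) + p * row zero             ≈⟨ distribˡ p _ _ ⟨
          p * (a * v zero + row zero)                 ≈⟨ *-congˡ (Av≈0 zero) ⟩
          p * 0#                                      ≈⟨ zeroʳ p ⟩
          0#                                          ∎
          where
          p*row≈0 : p * row zero ≈ 0#
          p*row≈0 = trans (*-distribˡ-sum {n} p _) (sum-zero n _ λ j →
            trans (solve 3 (λ p a v → p :* (a :* v) := a :* (p :* v)) refl p (A zero (suc j)) (v (suc j)))
              (trans (*-congˡ (pv≈0 j)) (zeroʳ _)))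
        kills (suc k) = trans (solve 3 (λ p a v → p :* a :* v := a :* (p :* v)) refl p a (v (suc k)))
          (trans (*-congˡ (pv≈0 k)) (zeroʳ a))

    -- The determinant trick: γ I - L kills `v`, so elimination yields a monic integer polynomial in
    -- γ that kills every `v k`. Faithfulness makes its value 0.
    stable⇒integral : ∀ n (v : Vector Carrier n) (L : Matrix ℤ n) →
      (∀ i → γ * v i ≈ sum (λ j → fromℤ (L i j) * v j)) →
      (∀ p → (∀ k → p * v k ≈ 0#) → p ≈ 0#) → IsIntegral γ
    stable⇒integral n v L γv≈Lv faithful = conclude (eliminate n A v A-val Av≈0)
      where
      A : Matrix Carrier n
      A i j = fromℤ (ℤ.- L i j) + γ * fromℤ (δ i j)

      A-val : ∀ i j → Value (δ i j) 1 (A i j)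
      A-val i j = step (ℤ.- L i j) (base refl) refl

      Av≈0 : ∀ i → sum (λ j → A i j * v j) ≈ 0#
      Av≈0 i = begin
        sum (λ j → A i j * v j)
          ≈⟨ sum-cong n (λ j → trans
               (*-congʳ (+-cong (fromℤ-homo-- (L i j)) (*-congˡ (fromℤ-δ i j))))
               (expand (fromℤ (L i j)) γ (1ᴹ i j) (v j))) ⟩
        sum (λ j → γ * (1ᴹ i j * v j) + - 1# * (fromℤ (L i j) * v j))
          ≈⟨ ∑-distrib-+ {n} _ _ ⟩
        sum (λ j → γ * (1ᴹ i j * v j)) + sum (λ j → - 1# * (fromℤ (L i j) * v j))
          ≈⟨ +-cong (*-distribˡ-sum {n} γ _) (*-distribˡ-sum {n} (- 1#) _) ⟨
        γ * sum (λ j → 1ᴹ i j * v j) + - 1# * sum (λ j → fromℤ (L i j) * v j)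
          ≈⟨ +-cong (*-congˡ (1ᴹ-sum i v)) (*-congˡ (sym (γv≈Lv i))) ⟩
        γ * v i + - 1# * (γ * v i)
          ≈⟨ solve 1 (λ x → x :+ :- con (+ 1) :* x := con (+ 0)) refl (γ * v i) ⟩
        0# ∎
        where
        expand = solve 4 (λ l g d v → (:- l :+ g :* d) :* v := g :* (d :* v) :+ :- con (+ 1) :* (l :* v)) refl

      conclude : (∃₂ λ d p → Value (+ 1) d p × (∀ k → p * v k ≈ 0#)) → IsIntegral γ
      conclude (d , p , p-val , pv≈0) = Value-1⇒integral p-val (faithful p pv≈0)

  integral-resp : ∀ {x y} → x ≈ y → IsIntegral x → IsIntegral y
  integral-resp x≈y (d , a , eq) = d , a , trans (evalMonic-cong d (λ _ → refl) (sym x≈y)) eq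

  fromℤ-integral : ∀ a → IsIntegral (fromℤ a)
  fromℤ-integral a = 1 , (λ _ → ℤ.- a) , (begin
    fromℤ a * 1# + (fromℤ (ℤ.- a) * 1# + 0#) ≈⟨ +-congˡ (+-congʳ (*-congʳ (fromℤ-homo-- a))) ⟩
    fromℤ a * 1# + (- fromℤ a * 1# + 0#)     ≈⟨ solve 1 (λ a → a :* con (+ 1) :+ (:- a :* con (+ 1) :+ con (+ 0)) := con (+ 0)) refl (fromℤ a) ⟩
    0# ∎)

  -- Multiplication by `x` moves a power to the next one; only the top power calls on the equation,
  -- hence the split by whether the index is last.
  companion : ∀ n (a : Vector ℤ (suc n)) x → evalMonic (λ i → fromℤ (a i)) x ≈ 0# →
    ∀ i → ∃ λ (r : Vector ℤ (suc n)) →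
          x * powers (suc n) x i ≈ sum (λ k → fromℤ (r k) * powers (suc n) x k)
  companion n a x fx≈0 i with view i
  ... | ‵inject₁ j = δ (suc j) , (begin
    x * x ^ toℕ (inject₁ j)                                     ≡⟨ ≡.cong (λ k → x * x ^ k) (Fin.toℕ-inject₁ j) ⟩
    powers (suc n) x (suc j)                                    ≈⟨ 1ᴹ-sum (suc j) (powers (suc n) x) ⟨
    sum (λ k → 1ᴹ (suc j) k * powers (suc n) x k)               ≈⟨ sum-cong (suc n) (λ k → *-congʳ {powers (suc n) x k} (fromℤ-δ (suc j) k)) ⟨
    sum (λ k → fromℤ (δ (suc j) k) * powers (suc n) x k)        ∎)
  ... | ‵fromℕ     = (λ k → ℤ.- a k) , (begin
    x * x ^ toℕ (Fin.fromℕ n)                                     ≡⟨ ≡.cong (λ k → x * x ^ k) (Fin.toℕ-fromℕ n) ⟩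
    x ^ suc n                                                   ≈⟨ solve 2 (λ x s → x := (x :+ s) :+ :- con (+ 1) :* s) refl (x ^ suc n) s ⟩
    evalMonic (λ i → fromℤ (a i)) x + - 1# * s                  ≈⟨ trans (+-congʳ fx≈0) (+-identityˡ _) ⟩
    - 1# * s                                                    ≈⟨ *-distribˡ-sum {suc n} (- 1#) (λ k → fromℤ (a k) * powers (suc n) x k) ⟩
    sum (λ k → - 1# * (fromℤ (a k) * powers (suc n) x k))       ≈⟨ sum-cong (suc n) (λ k → negate (fromℤ (a k)) (powers (suc n) x k)) ⟩
    sum (λ k → - fromℤ (a k) * powers (suc n) x k)              ≈⟨ sum-cong (suc n) (λ k → *-congʳ {powers (suc n) x k} (fromℤ-homo-- (a k))) ⟨
    sum (λ k → fromℤ (ℤ.- a k) * powers (suc n) x k)            ∎)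
    where
    s = sum (λ k → fromℤ (a k) * powers (suc n) x k)
    negate = solve 2 (λ a p → :- con (+ 1) :* (a :* p) := :- a :* p) refl

  sum-++ : ∀ m n (f : Vector Carrier (m ℕ.+ n)) →
           sum f ≈ sum (λ i → f (i ↑ˡ n)) + sum (λ j → f (m ↑ʳ j))
  sum-++ zero    n f = sym (+-identityˡ _)
  sum-++ (suc m) n f = trans (+-congˡ (sum-++ m n (f ∘ suc))) (sym (+-assoc _ _ _))

  sum-combine : ∀ m n (f : Vector Carrier (m ℕ.* n)) →
                sum f ≈ sum {m} (λ i → sum {n} (λ j → f (combine i j)))
  sum-combine zero    n f = refl
  sum-combine (suc m) n f = trans (sum-++ n (m ℕ.* n) f) (+-congˡ (sum-combine m n _))

  sum-*-sum : ∀ m n (x : Vector Carrier m) (y : Vector Carrier n) →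
              sum x * sum y ≈ sum (λ i → sum (λ j → x i * y j))
  sum-*-sum m n x y = trans (*-distribʳ-sum {m} (sum y) x) (sum-cong m λ i → *-distribˡ-sum {n} (x i) y)

  -- The monomials x ^ k * y ^ l with k < deg x and l < deg y span a module stable under x * y.
  *-integral : ∀ {x y} → IsIntegral x → IsIntegral y → IsIntegral (x * y)
  -- A monic polynomial of degree 0 is the constant 1, so `eq` says that the ring is trivial and
  -- serves for the product as well.
  *-integral (zero  , a , eq) _                = zero , (λ ()) , eq
  *-integral (suc m , _)      (zero , b , eq)  = zero , (λ ()) , eq
  *-integral {x} {y} (suc m , a , fx≈0) (suc n , b , gy≈0) =
    stable⇒integral (x * y) (suc m ℕ.* suc n) (v ∘ remQuot (suc n)) (λ r s → L (remQuot (suc n) r) (remQuot (suc n) s))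
      stable faithful
    where
    Index = Fin (suc m) × Fin (suc n)

    r = λ k → proj₁ (companion m a x fx≈0 k)
    s = λ l → proj₁ (companion n b y gy≈0 l)

    v : Index → Carrier
    v (k , l) = powers (suc m) x k * powers (suc n) y l

    L : Index → Index → ℤ
    L (k , l) (k′ , l′) = r k k′ ℤ.* s l l′

    row : ∀ i → x * y * v i ≈ sum (λ k → sum (λ l → fromℤ (L i (k , l)) * v (k , l)))
    row (k , l) = begin
      x * y * v (k , l)
        ≈⟨ regroup x y (powers (suc m) x k) (powers (suc n) y l) ⟩
      (x * powers (suc m) x k) * (y * powers (suc n) y l)
        ≈⟨ *-cong (proj₂ (companion m a x fx≈0 k)) (proj₂ (companion n b y gy≈0 l)) ⟩
      sum (λ k′ → fromℤ (r k k′) * powers (suc m) x k′) * sum (λ l′ → fromℤ (s l l′) * powers (suc n) y l′)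
        ≈⟨ sum-*-sum (suc m) (suc n) (λ k′ → fromℤ (r k k′) * powers (suc m) x k′) (λ l′ → fromℤ (s l l′) * powers (suc n) y l′) ⟩
      sum (λ k′ → sum (λ l′ → (fromℤ (r k k′) * powers (suc m) x k′) * (fromℤ (s l l′) * powers (suc n) y l′)))
        ≈⟨ sum-cong (suc m) (λ k′ → sum-cong (suc n) (λ l′ → trans
             (regroup (fromℤ (r k k′)) (powers (suc m) x k′) (fromℤ (s l l′)) (powers (suc n) y l′))
             (*-congʳ (sym (fromℤ-homo-* (r k k′) (s l l′)))))) ⟩
      sum (λ k′ → sum (λ l′ → fromℤ (L (k , l) (k′ , l′)) * v (k′ , l′))) ∎
      where
      regroup = solve 4 (λ a b c d → a :* b :* (c :* d) := (a :* c) :* (b :* d)) refl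

    stable : ∀ i → x * y * v (remQuot (suc n) i) ≈
             sum (λ j → fromℤ (L (remQuot (suc n) i) (remQuot (suc n) j)) * v (remQuot (suc n) j))
    stable i = trans (row i′) (trans
      (sum-cong (suc m) λ k → sum-cong (suc n) λ l → reflexive
        (≡.cong (λ j → fromℤ (L i′ j) * v j) (≡.sym (Fin.remQuot-combine {suc m} k l))))
      (sym (sum-combine (suc m) (suc n) (λ j → fromℤ (L i′ (remQuot (suc n) j)) * v (remQuot (suc n) j)))))
      where i′ = remQuot (suc n) i

    -- The generator with both exponents 0 is 1.
    faithful : ∀ p → (∀ k → p * v (remQuot (suc n) k) ≈ 0#) → p ≈ 0#
    faithful p pv≈0 = trans (sym (trans (*-congˡ (*-identityʳ 1#)) (*-identityʳ p)))
      (≡.subst (λ i → p * v i ≈ 0#) (Fin.remQuot-combine {suc m} {suc n} zero zero) (pv≈0 (combine {suc m} zero zero)))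

  neg-integral : ∀ {x} → IsIntegral x → IsIntegral (- x)
  neg-integral {x} int = integral-resp (solve 1 (λ x → con -[1+ 0 ] :* x := :- x) refl x)
    (*-integral (fromℤ-integral -[1+ 0 ]) int)

  product-integral : ∀ n (x : Vector Carrier n) → (∀ i → IsIntegral (x i)) → IsIntegral (product x)
  product-integral zero    x int = integral-resp (+-identityʳ 1#) (fromℤ-integral (+ 1))
  product-integral (suc n) x int = *-integral (int zero) (product-integral n (x ∘ suc) (int ∘ suc))

  ^-integral : ∀ n {x} → IsIntegral x → IsIntegral (x ^ n)
  ^-integral zero    int = integral-resp (+-identityʳ 1#) (fromℤ-integral (+ 1))
  ^-integral (suc n) int = *-integral int (^-integral n int)

-- Binary forms: division by a root, splitting, and the determinant of X I - Y C.

module BinaryForm {c ℓ} (R : CommutativeRing c ℓ) where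
  open CommutativeRing R hiding (zero)
  open RawRingDefs rawRing
  open IntegerCoefficients R
  open RingLemmas R
  open import Relation.Binary.Reasoning.Setoid setoid
  open AbelianGroupProperties +-abelianGroup using (x∙y⁻¹≈ε⇒x≈y)

  -- The homogenization Y ^ n * f (X / Y) of the monic polynomial f of degree n with lower coefficients a.
  form : ∀ n → Vector Carrier n → Carrier → Carrier → Carrier
  form zero    a X Y = 1#
  form (suc n) a X Y = a zero * Y ^ suc n + X * form n (tail a) X Y

  form-1 : ∀ n (a : Vector Carrier n) x → form n a x 1# ≈ evalMonic a x
  form-1 zero    a x = sym (+-identityʳ 1#)
  form-1 (suc n) a x = trans
    (+-cong (trans (*-congˡ (1^n≈1 (suc n))) (*-identityʳ _)) (*-congˡ (form-1 n (tail a) x)))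
    (sym (horner n a x))

  -- Synthetic division: the lower coefficients of (f(x) - f(z)) / (x - z). Writing f(x) = a₀ + x
  -- g(x), this quotient is g(z) + x (g(x) - g(z)) / (x - z), which is the recursion used.
  quotient : ∀ n → Vector Carrier (suc n) → Carrier → Vector Carrier n
  quotient (suc n) a z = evalMonic (tail a) z ∷ quotient n (tail a) z

  form-division : ∀ n (a : Vector Carrier (suc n)) z X Y →
    form (suc n) a X Y ≈ evalMonic a z * Y ^ suc n + (X - z * Y) * form n (quotient n a z) X Y
  form-division zero    a z X Y = begin
    a zero * (Y * 1#) + X * 1#                                        ≈⟨ regroup (a zero) z X Y ⟩
    (a zero + z * (1# + 0#)) * (Y * 1#) + (X - z * Y) * 1#            ≈⟨ +-congʳ (*-congʳ (horner 0 a z)) ⟨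
    evalMonic a z * (Y * 1#) + (X - z * Y) * 1#                       ∎
    where
    regroup = solve 4 (λ a z X Y → a :* (Y :* con (+ 1)) :+ X :* con (+ 1) :=
      (a :+ z :* (con (+ 1) :+ con (+ 0))) :* (Y :* con (+ 1)) :+ (X :- z :* Y) :* con (+ 1)) refl
  form-division (suc n) a z X Y = begin
    a zero * Y ^ suc (suc n) + X * form (suc n) (tail a) X Y
      ≈⟨ +-congˡ (*-congˡ (form-division n (tail a) z X Y)) ⟩
    a zero * (Y * Y ^ suc n) + X * (e * Y ^ suc n + (X - z * Y) * q)
      ≈⟨ regroup (a zero) z X Y (Y ^ suc n) e q ⟩
    (a zero + z * e) * (Y * Y ^ suc n) + (X - z * Y) * (e * Y ^ suc n + X * q)
      ≈⟨ +-congʳ (*-congʳ (horner (suc n) a z)) ⟨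
    evalMonic a z * Y ^ suc (suc n) + (X - z * Y) * form (suc n) (quotient (suc n) a z) X Y ∎
    where
    e = evalMonic (tail a) z
    q = form n (quotient n (tail a) z) X Y
    regroup = solve 7 (λ a z X Y p e q →
      a :* (Y :* p) :+ X :* (e :* p :+ (X :- z :* Y) :* q) :=
      (a :+ z :* e) :* (Y :* p) :+ (X :- z :* Y) :* (e :* p :+ X :* q)) refl

  form-root : ∀ n (a : Vector Carrier (suc n)) z → evalMonic a z ≈ 0# → ∀ X Y →
              form (suc n) a X Y ≈ (X - z * Y) * form n (quotient n a z) X Y
  form-root n a z fz≈0 X Y = trans (form-division n a z X Y)
    (trans (+-congʳ (trans (*-congʳ fz≈0) (zeroˡ _))) (+-identityˡ _))

  -- Roots are divided out one at a time. A later root differs from the one removed, so `cancel`,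
  -- applied at Y = 1, shows that it is a root of the quotient too.
  form-factorization : (∀ {x y} → x * y ≈ 0# → ¬ (x ≈ 0#) → y ≈ 0#) →
    ∀ n (a z : Vector Carrier n) → (∀ k → evalMonic a (z k) ≈ 0#) →
    (∀ i k → z i ≈ z k → i ≡ k) → ∀ X Y → form n a X Y ≈ product (λ k → X - z k * Y)
  form-factorization cancel zero    a z root distinct X Y = refl
  form-factorization cancel (suc n) a z root distinct X Y = trans (form-root n a (z zero) (root zero) X Y)
    (*-congˡ (form-factorization cancel n (quotient n a (z zero)) (tail z) root′
      (λ i k eq → Fin.suc-injective (distinct (suc i) (suc k) eq)) X Y))
    where
    root′ : ∀ k → evalMonic (quotient n a (z zero)) (z (suc k)) ≈ 0#
    root′ k = trans (sym (form-1 n _ w)) (cancel factored w≉z₀)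
      where
      w = z (suc k)

      factored : (w - z zero * 1#) * form n (quotient n a (z zero)) w 1# ≈ 0#
      factored = trans (sym (form-root n a (z zero) (root zero) w 1#))
        (trans (form-1 (suc n) a w) (root (suc k)))

      w≉z₀ : ¬ (w - z zero * 1# ≈ 0#)
      w≉z₀ eq with distinct (suc k) zero (x∙y⁻¹≈ε⇒x≈y _ _ (trans (+-congˡ (-‿cong (sym (*-identityʳ _)))) eq))
      ... | ()

  -- With C the companion matrix of f and w = Y f, the matrix X I - Y C is
  -- multiplication n X w.  A general corner entry t makes the family closed
  -- under the two minors occurring in the expansion along the first row.
  module _ (X Y : Carrier) where

    -- The column (t, 0, ..., 0, u), with the single entry t + u when top and bottom coincide. As
    -- first column of `multiplication` it holds the corner and the constant coefficient of the
    -- reduced top power.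
    column : ∀ n → Carrier → Carrier → Fin (suc n) → Carrier
    column zero    t u _       = t + u
    column (suc n) t u zero    = t
    column (suc n) t u (suc i) = column n 0# u i

    multiplication : ∀ n → Carrier → Vector Carrier (suc n) → Matrix Carrier (suc n)
    multiplication n       t w i       zero          = column n t (w zero) i
    multiplication (suc n) t w zero    (suc zero)    = - Y
    multiplication (suc n) t w zero    (suc (suc k)) = 0#
    multiplication (suc n) t w (suc i) (suc k)       = multiplication n X (tail w) i k

    -- Deleting row 0 takes the top entry `t` off the first column, which leaves corner 0; deleting
    -- column 1 drops the second entry of `w`.
    minor : ∀ n t (w : Vector Carrier (suc (suc n))) i k →
            multiplication (suc n) t w (suc i) (punchIn (suc zero) k) ≈
            multiplication n 0# (w zero ∷ tail (tail w)) i k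
    minor n       t w i       zero          = refl
    minor (suc n) t w zero    (suc zero)    = refl
    minor (suc n) t w zero    (suc (suc k)) = refl
    minor (suc n) t w (suc i) (suc k)       = refl

    -- The first row is (t, -Y, 0, ..., 0). The minor at `t` is the same matrix for `tail f` with
    -- corner `X`; the minor at -Y has corner 0 and so reduces to one power of `Y` times `f zero`.
    -- For t = X the value is `form (suc n) f X Y`.
    det-multiplication : ∀ n t (w f : Vector Carrier (suc n)) → (∀ k → w k ≈ Y * f k) →
      det (multiplication n t w) ≈ f zero * Y ^ suc n + t * form n (tail f) X Y
    det-multiplication zero    t w f w≈Yf = begin
      1# * ((t + w zero) * 1#) + 0#       ≈⟨ +-congʳ (*-congˡ (*-congʳ (+-congˡ (w≈Yf zero)))) ⟩
      1# * ((t + Y * f zero) * 1#) + 0#   ≈⟨ regroup t Y (f zero) ⟩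
      f zero * (Y * 1#) + t * 1#          ∎
      where
      regroup = solve 3 (λ t Y f → con (+ 1) :* ((t :+ Y :* f) :* con (+ 1)) :+ con (+ 0) :=
        f :* (Y :* con (+ 1)) :+ t :* con (+ 1)) refl
    det-multiplication (suc n) t w f w≈Yf = begin
      1# * (t * d₀) + (- 1# * 1# * (- Y * d₁) + sum (λ j → (- 1#) ^ toℕ (suc (suc j)) * (0# * d₂ j)))
        ≈⟨ +-congˡ (+-congˡ (sum-zero n _ λ j → trans (*-congˡ (zeroˡ (d₂ j))) (zeroʳ _))) ⟩
      1# * (t * d₀) + (- 1# * 1# * (- Y * d₁) + 0#)
        ≈⟨ solve 4 (λ t d Y e → con (+ 1) :* (t :* d) :+ ((:- con (+ 1)) :* con (+ 1) :* (:- Y :* e) :+ con (+ 0))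
             := t :* d :+ Y :* e) refl t d₀ Y d₁ ⟩
      t * d₀ + Y * d₁
        ≈⟨ +-cong (*-congˡ (det-multiplication n X (tail w) (tail f) (w≈Yf ∘ suc)))
                  (*-congˡ (trans (det-cong (suc n) (minor n t w))
                    (det-multiplication n 0# (w zero ∷ tail (tail w)) (f zero ∷ tail (tail f)) w≈Yf′))) ⟩
      t * form (suc n) (tail f) X Y + Y * (f zero * Y ^ suc n + 0# * form n (tail (tail f)) X Y)
        ≈⟨ solve 6 (λ t g Y p h e → t :* g :+ Y :* (h :* p :+ con (+ 0) :* e) := h :* (Y :* p) :+ t :* g) refl
             t (form (suc n) (tail f) X Y) Y (Y ^ suc n) (f zero) (form n (tail (tail f)) X Y) ⟩
      f zero * Y ^ suc (suc n) + t * form (suc n) (tail f) X Y ∎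
      where
      A = multiplication (suc n) t w
      d₀ = det (λ i k → A (suc i) (punchIn zero k))
      d₁ = det (λ i k → A (suc i) (punchIn (suc zero) k))
      d₂ : Fin n → Carrier
      d₂ j = det (λ i k → A (suc i) (punchIn (suc (suc j)) k))
      w≈Yf′ : ∀ k → (w zero ∷ tail (tail w)) k ≈ Y * (f zero ∷ tail (tail f)) k
      w≈Yf′ zero    = w≈Yf zero
      w≈Yf′ (suc k) = w≈Yf (suc (suc k))

    column-zero : ∀ n {t u} i → t ≈ 0# → u ≈ 0# → column n t u i ≈ 0#
    column-zero zero    i       t≈0 u≈0 = trans (+-cong t≈0 u≈0) (+-identityʳ 0#)
    column-zero (suc n) zero    t≈0 u≈0 = t≈0
    column-zero (suc n) (suc i) t≈0 u≈0 = column-zero n i refl u≈0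

    column-linear : ∀ n {s} x u v i → s ≈ 0# →
                    column n 0# u i + x * column n s v i ≈ column n 0# (u + x * v) i
    column-linear zero    x u v i       s≈0 = trans (+-congˡ (*-congˡ (+-congʳ s≈0)))
      (solve 3 (λ x u v → (con (+ 0) :+ u) :+ x :* (con (+ 0) :+ v) := con (+ 0) :+ (u :+ x :* v)) refl x u v)
    column-linear (suc n) x u v zero    s≈0 = trans (+-identityˡ _) (trans (*-congˡ s≈0) (zeroʳ x))
    column-linear (suc n) x u v (suc i) s≈0 = column-linear n x u v i refl

    column-cong : ∀ n {t u v} i → u ≈ v → column n t u i ≈ column n t v i
    column-cong zero    i       u≈v = +-congˡ u≈v
    column-cong (suc n) zero    u≈v = refl
    column-cong (suc n) (suc i) u≈v = column-cong n i u≈v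

    -- The `column` term is the defect from multiplication by X - Y x. Its top vanishes for t = X,
    -- and its bottom is Y f(x) for w = Y f. It is carried along because a root of f need not be a
    -- root of the truncations met in the induction.
    multiplication-powers : ∀ n t (w : Vector Carrier (suc n)) x i →
      sum (λ k → multiplication n t w i k * powers (suc n) x k) ≈
      (X - Y * x) * x ^ toℕ i + column n (t - X) (Y * x ^ suc n + sum (λ k → w k * powers (suc n) x k)) i
    multiplication-powers zero    t w x zero = solve 5
      (λ t w X Y x → (t :+ w) :* con (+ 1) :+ con (+ 0) :=
        (X :- Y :* x) :* con (+ 1) :+ ((t :- X) :+ (Y :* (x :* con (+ 1)) :+ (w :* con (+ 1) :+ con (+ 0)))))
      refl t (w zero) X Y x
    multiplication-powers (suc n) t w x zero = trans
      (+-congˡ (+-congˡ (sum-zero n _ λ k → zeroˡ (powers (suc (suc n)) x (suc (suc k))))))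
      (solve 4 (λ t X Y x → t :* con (+ 1) :+ (:- Y :* (x :* con (+ 1)) :+ con (+ 0)) :=
        (X :- Y :* x) :* con (+ 1) :+ (t :- X)) refl t X Y x)
    multiplication-powers (suc n) t w x (suc i) = begin
      sum (λ k → multiplication (suc n) t w (suc i) k * powers (suc (suc n)) x k)
        ≈⟨ sum-powers-horner (suc n) (multiplication (suc n) t w (suc i)) x ⟩
      column n 0# (w zero) i + x * sum (λ k → multiplication n X (tail w) i k * powers (suc n) x k)
        ≈⟨ +-congˡ (*-congˡ (multiplication-powers n X (tail w) x i)) ⟩
      column n 0# (w zero) i + x * ((X - Y * x) * x ^ toℕ i + column n (X - X) r i)
        ≈⟨ solve 6 (λ X Y x p u v → u :+ x :* ((X :- Y :* x) :* p :+ v) := (X :- Y :* x) :* (x :* p) :+ (u :+ x :* v))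
             refl X Y x (x ^ toℕ i) (column n 0# (w zero) i) (column n (X - X) r i) ⟩
      (X - Y * x) * x ^ toℕ (suc i) + (column n 0# (w zero) i + x * column n (X - X) r i)
        ≈⟨ +-congˡ (column-linear n x (w zero) r i (-‿inverseʳ X)) ⟩
      (X - Y * x) * x ^ toℕ (suc i) + column n 0# (w zero + x * r) i
        ≈⟨ +-congˡ (column-cong n i (trans
             (solve 5 (λ w x Y p s → w :+ x :* (Y :* p :+ s) := Y :* (x :* p) :+ (w :+ x :* s)) refl
               (w zero) x Y (x ^ suc n) (sum (λ k → tail w k * powers (suc n) x k)))
             (+-congˡ (sym (sum-powers-horner (suc n) w x))))) ⟩
      (X - Y * x) * x ^ toℕ (suc i) + column n 0# (Y * x ^ suc (suc n) + sum (λ k → w k * powers (suc (suc n)) x k)) i ∎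
      where
      r = Y * x ^ suc n + sum (λ k → tail w k * powers (suc n) x k)

-- The relative norm of X - αY as a value of the binary form of f.

module NormForm {c₁ ℓ₁ c₂ ℓ₂} (R : CommutativeRing c₁ ℓ₁) (S : CommutativeRing c₂ ℓ₂)
  {φ : CommutativeRing.Carrier R → CommutativeRing.Carrier S}
  (φ-isHom : IsHom (CommutativeRing.rawRing R) (CommutativeRing.rawRing S) φ) where
  private
    module R where
      open CommutativeRing R public hiding (zero)
      open RawRingDefs rawRing public
      open BinaryForm R public
      open RingLemmas R public
      open AbelianGroupProperties +-abelianGroup public using (x∙y⁻¹≈ε⇒x≈y)
    module S = BinaryForm S
  open CommutativeRing S hiding (zero)
  open RawRingDefs rawRing
  open RingLemmas S
  open IntegerCoefficients S
  open RingMorphisms.IsRingHomomorphism φ-isHom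
  open HomomorphismLemmas R S φ-isHom
  open ExtensionDefs R.rawRing rawRing φ
  open import Relation.Binary.Reasoning.Setoid setoid
  open Sum semiring using (∑-distrib-+; *-distribˡ-sum)

  form-homo : ∀ n a X Y → φ (R.form n a X Y) ≈ S.form n (φ ∘ a) (φ X) (φ Y)
  form-homo zero    a X Y = 1#-homo
  form-homo (suc n) a X Y = trans (+-homo _ _)
    (+-cong (trans (*-homo _ _) (*-congˡ (^-homo Y (suc n))))
            (trans (*-homo _ _) (*-congˡ (form-homo n (tail a) X Y))))

  column-homo : ∀ X Y n t u i → φ (R.column X Y n t u i) ≈ S.column (φ X) (φ Y) n (φ t) (φ u) i
  column-homo X Y zero    t u i       = +-homo _ _
  column-homo X Y (suc n) t u zero    = refl
  -- Below the top the corner is reset to `0#`, which `φ` preserves only up to `≈`; hence the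
  -- separate cases.
  column-homo X Y (suc zero)    t u (suc i) = trans (+-homo _ _) (+-congʳ 0#-homo)
  column-homo X Y (suc (suc n)) t u (suc zero) = 0#-homo
  column-homo X Y (suc (suc n)) t u (suc (suc i)) = column-homo X Y (suc n) t u (suc i)

  multiplication-homo : ∀ X Y n t w i k →
    φ (R.multiplication X Y n t w i k) ≈ S.multiplication (φ X) (φ Y) n (φ t) (φ ∘ w) i k
  multiplication-homo X Y n       t w i       zero          = column-homo X Y n t (w zero) i
  multiplication-homo X Y (suc n) t w zero    (suc zero)    = -‿homo Y
  multiplication-homo X Y (suc n) t w zero    (suc (suc k)) = 0#-homo
  multiplication-homo X Y (suc n) t w (suc i) (suc k)       = multiplication-homo X Y n X (tail w) i k

  multiplication-acts : ∀ n {α} (f : Vector R.Carrier (suc n)) → evalMonic (φ ∘ f) α ≈ 0# → ∀ X Y i →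
    (φ X - α * φ Y) * powers (suc n) α i ≈
    combination (powers (suc n) α) (R.multiplication X Y n X (λ k → Y R.* f k) i)
  multiplication-acts n {α} f fα≈0 X Y i = sym (begin
    sum (λ k → φ (R.multiplication X Y n X w i k) * powers (suc n) α k)
      ≈⟨ sum-cong (suc n) (λ k → *-congʳ {powers (suc n) α k} (multiplication-homo X Y n X w i k)) ⟩
    sum (λ k → S.multiplication (φ X) (φ Y) n (φ X) (φ ∘ w) i k * powers (suc n) α k)
      ≈⟨ S.multiplication-powers (φ X) (φ Y) n (φ X) (φ ∘ w) α i ⟩
    (φ X - φ Y * α) * powers (suc n) α i + S.column (φ X) (φ Y) n (φ X - φ X) (φ Y * α ^ suc n + sum (λ k → φ (w k) * powers (suc n) α k)) i
      ≈⟨ +-cong (*-congʳ (+-congˡ (-‿cong (*-comm (φ Y) α))))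
                (S.column-zero (φ X) (φ Y) n i (-‿inverseʳ (φ X)) defect≈0) ⟩
    (φ X - α * φ Y) * powers (suc n) α i + 0#
      ≈⟨ +-identityʳ _ ⟩
    (φ X - α * φ Y) * powers (suc n) α i ∎)
    where
    w = λ k → Y R.* f k

    defect≈0 : φ Y * α ^ suc n + sum (λ k → φ (w k) * powers (suc n) α k) ≈ 0#
    defect≈0 = begin
      φ Y * α ^ suc n + sum (λ k → φ (w k) * powers (suc n) α k)
        ≈⟨ +-congˡ (sum-cong (suc n) λ k → trans (*-congʳ {powers (suc n) α k} (*-homo Y (f k))) (*-assoc _ _ _)) ⟩
      φ Y * α ^ suc n + sum (λ k → φ Y * (φ (f k) * powers (suc n) α k))
        ≈⟨ +-congˡ (*-distribˡ-sum {suc n} (φ Y) (λ k → φ (f k) * powers (suc n) α k)) ⟨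
      φ Y * α ^ suc n + φ Y * sum (λ k → φ (f k) * powers (suc n) α k)
        ≈⟨ distribˡ (φ Y) _ _ ⟨
      φ Y * evalMonic (φ ∘ f) α
        ≈⟨ trans (*-congˡ fα≈0) (zeroʳ _) ⟩
      0# ∎

  independent-unique : ∀ n {e : Vector Carrier n} → IsIndependent e → ∀ {a b : Vector R.Carrier n} →
    combination e a ≈ combination e b → ∀ i → a i R.≈ b i
  independent-unique n {e} indep {a} {b} eq i = R.x∙y⁻¹≈ε⇒x≈y (a i) (b i) (indep (λ k → a k R.- b k) (begin
    sum (λ k → φ (a k R.- b k) * e k)
      ≈⟨ sum-cong n (λ k → trans (*-congʳ (trans (+-homo _ _) (+-congˡ (-‿homo _)))) (expand (φ (a k)) (φ (b k)) (e k))) ⟩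
    sum (λ k → φ (a k) * e k + - 1# * (φ (b k) * e k))
      ≈⟨ ∑-distrib-+ {n} _ _ ⟩
    combination e a + sum (λ k → - 1# * (φ (b k) * e k))
      ≈⟨ +-cong eq (sym (*-distribˡ-sum {n} (- 1#) _)) ⟩
    combination e b + - 1# * combination e b
      ≈⟨ solve 1 (λ x → x :+ :- con (+ 1) :* x := con (+ 0)) refl (combination e b) ⟩
    0# ∎) i)
    where
    expand = solve 3 (λ a b e → (a :- b) :* e := a :* e :+ :- con (+ 1) :* (b :* e)) refl

  norm≈form : ∀ n {α f X Y ν} → IsMinimalPolynomial {suc n} α f →
              IsNorm (powers (suc n) α) (φ X - α * φ Y) ν → R.form (suc n) f X Y R.≈ ν
  norm≈form n {α} {f} {X} {Y} min (L , βe≈Le , det≈ν) = R.trans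
    (R.sym (R.det-multiplication X Y n X (λ k → Y R.* f k) f (λ _ → R.refl)))
    (R.trans (R.det-cong (suc n) {R.multiplication X Y n X (λ k → Y R.* f k)} {L}
      (λ i → independent-unique (suc n) {powers (suc n) α} minimal
      {R.multiplication X Y n X (λ k → Y R.* f k) i} {L i} (trans (sym (multiplication-acts n f root X Y i)) (βe≈Le i)))) det≈ν)
    where open IsMinimalPolynomial min

-- Inequalities, extrema, the Archimedean property and square roots in ℝ.

module OrderedField {r ℓ₁ ℓ₂ ℓ₃} (ℝ : CompleteOrderedField r ℓ₁ ℓ₂ ℓ₃) where
  open CompleteOrderedField ℝ hiding (zero)
  open Reals ℝ
  open IntegerCoefficients commutativeRing
  open RingLemmas commutativeRing
  open PosetReasoning poset
  open Max totalOrder using (x≤x⊔y; ⊔-lub; ⊔-sel)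
  open HeytingProperties heytingCommutativeRing using (1#0; x-0≈x)
  open CommutativeExp commutativeSemiring using (^-distrib-*)

  private
    variable
      x y z w : Carrier

  1≉0 : ¬ (1# ≈ 0#)
  1≉0 eq = HeytingCommutativeRing.#-irrefl heytingCommutativeRing eq 1#0

  ≰⇒≥ : ¬ (x ≤ y) → y ≤ x
  ≰⇒≥ {x} {y} x≰y with total x y
  ... | inj₁ x≤y = contradiction x≤y x≰y
  ... | inj₂ y≤x = y≤x

  ≮⇒≥ : ¬ (x < y) → y ≤ x
  ≮⇒≥ {x} {y} x≮y with x ≈? y
  ... | yes x≈y = ≤-reflexive (sym x≈y)
  ... | no  x≉y = ≰⇒≥ λ x≤y → x≮y (x≤y , x≉y)

  <⇒≱ : x < y → ¬ (y ≤ x)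
  <⇒≱ (x≤y , x≉y) y≤x = x≉y (antisym x≤y y≤x)

  ≤-<-trans : x ≤ y → y < z → x < z
  ≤-<-trans x≤y y<z = ≤-trans x≤y (proj₁ y<z) , λ x≈z → <⇒≱ y<z (≤-trans (≤-reflexive (sym x≈z)) x≤y)

  <-≤-trans : x < y → y ≤ z → x < z
  <-≤-trans x<y y≤z = ≤-trans (proj₁ x<y) y≤z , λ x≈z → <⇒≱ x<y (≤-trans y≤z (≤-reflexive (sym x≈z)))

  0≤∧≉⇒0< : 0# ≤ x → ¬ (x ≈ 0#) → 0# < x
  0≤∧≉⇒0< 0≤x x≉0 = 0≤x , λ 0≈x → x≉0 (sym 0≈x)

  0<⇒≉ : 0# < x → ¬ (x ≈ 0#)
  0<⇒≉ 0<x x≈0 = proj₂ 0<x (sym x≈0)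

  0<1 : 0# < 1#
  0<1 = 0≤∧≉⇒0< 0≤1 1≉0

  +-mono-≤ : x ≤ y → z ≤ w → x + z ≤ y + w
  +-mono-≤ {x} {y} {z} {w} x≤y z≤w = begin
    x + z ≤⟨ +-monoʳ-≤ x z≤w ⟩
    x + w ≈⟨ +-comm x w ⟩
    w + x ≤⟨ +-monoʳ-≤ w x≤y ⟩
    w + y ≈⟨ +-comm w y ⟩
    y + w ∎

  x≤y⇒0≤y-x : x ≤ y → 0# ≤ y - x
  x≤y⇒0≤y-x {x} {y} x≤y = begin
    0#      ≈⟨ -‿inverseˡ x ⟨
    - x + x ≤⟨ +-monoʳ-≤ (- x) x≤y ⟩
    - x + y ≈⟨ +-comm (- x) y ⟩
    y - x   ∎

  0≤y-x⇒x≤y : 0# ≤ y - x → x ≤ y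
  0≤y-x⇒x≤y {y} {x} 0≤y-x = begin
    x           ≈⟨ +-identityʳ x ⟨
    x + 0#      ≤⟨ +-monoʳ-≤ x 0≤y-x ⟩
    x + (y - x) ≈⟨ solve 2 (λ x y → x :+ (y :- x) := y) refl x y ⟩
    y           ∎

  x≤x+y : 0# ≤ y → x ≤ x + y
  x≤x+y {y} {x} 0≤y = ≤-trans (≤-reflexive (sym (+-identityʳ x))) (+-monoʳ-≤ x 0≤y)

  *-monoʳ-≤ : 0# ≤ z → x ≤ y → z * x ≤ z * y
  *-monoʳ-≤ {z} {x} {y} 0≤z x≤y = begin
    z * x ≈⟨ *-comm z x ⟩
    x * z ≤⟨ *-monoˡ-≤ 0≤z x≤y ⟩
    y * z ≈⟨ *-comm y z ⟩
    z * y ∎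

  *-mono-≤ : 0# ≤ y → 0# ≤ z → x ≤ y → z ≤ w → x * z ≤ y * w
  *-mono-≤ 0≤y 0≤z x≤y z≤w = ≤-trans (*-monoˡ-≤ 0≤z x≤y) (*-monoʳ-≤ 0≤y z≤w)

  *-inverseʳ : ¬ (x ≈ 0#) → x * x ⁻¹ ≈ 1#
  *-inverseʳ {x} x≉0 with x ≈? 0#
  ... | yes x≈0 = contradiction x≈0 x≉0
  ... | no x≉0′ = trans (*-congʳ (sym (x-0≈x x))) (proj₂ (proj₂ (#⇒invertible (≉⇒# x≉0′))))

  *-cancel-≈0 : x * y ≈ 0# → ¬ (x ≈ 0#) → y ≈ 0#
  *-cancel-≈0 {x} {y} xy≈0 x≉0 = begin-equality
    y              ≈⟨ *-identityˡ y ⟨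
    1# * y         ≈⟨ *-congʳ (*-inverseʳ x≉0) ⟨
    x * x ⁻¹ * y   ≈⟨ solve 3 (λ x y i → x :* i :* y := i :* (x :* y)) refl x y (x ⁻¹) ⟩
    x ⁻¹ * (x * y) ≈⟨ trans (*-congˡ xy≈0) (zeroʳ _) ⟩
    0#             ∎

  x*x≈0⇒x≈0 : x * x ≈ 0# → x ≈ 0#
  x*x≈0⇒x≈0 {x} xx≈0 with x ≈? 0#
  ... | yes x≈0 = x≈0
  ... | no  x≉0 = *-cancel-≈0 xx≈0 x≉0

  0<x*y : 0# < x → 0# < y → 0# < x * y
  0<x*y 0<x 0<y = 0≤∧≉⇒0< (*-nonNeg (proj₁ 0<x) (proj₁ 0<y)) λ xy≈0 → 0<⇒≉ 0<y (*-cancel-≈0 xy≈0 (0<⇒≉ 0<x))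

  0≤x⁻¹ : 0# < x → 0# ≤ x ⁻¹
  0≤x⁻¹ {x} 0<x with total 0# (x ⁻¹)
  ... | inj₁ 0≤i = 0≤i
  ... | inj₂ i≤0 = contradiction (begin
    1#       ≈⟨ *-inverseʳ (0<⇒≉ 0<x) ⟨
    x * x ⁻¹ ≤⟨ *-monoʳ-≤ (proj₁ 0<x) i≤0 ⟩
    x * 0#   ≈⟨ zeroʳ x ⟩
    0#       ∎) (<⇒≱ 0<1)

  *-cancelʳ-≤ : 0# < z → x * z ≤ y * z → x ≤ y
  *-cancelʳ-≤ {z} {x} {y} 0<z xz≤yz = begin
    x              ≈⟨ undo x ⟨
    x * z * z ⁻¹   ≤⟨ *-monoˡ-≤ (0≤x⁻¹ 0<z) xz≤yz ⟩
    y * z * z ⁻¹   ≈⟨ undo y ⟩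
    y              ∎
    where
    undo : ∀ t → t * z * z ⁻¹ ≈ t
    undo t = trans (*-assoc t z _) (trans (*-congˡ (*-inverseʳ (0<⇒≉ 0<z))) (*-identityʳ t))

  -- Adding x y to both sides gives x (x + y) ≤ y (x + y), where x + y cancels unless it is 0.
  x*x≤y*y⇒x≤y : 0# ≤ y → x * x ≤ y * y → x ≤ y
  x*x≤y*y⇒x≤y {y} {x} 0≤y xx≤yy with total x y
  ... | inj₁ x≤y = x≤y
  ... | inj₂ y≤x with (x + y) ≈? 0#
  ... | yes x+y≈0 = begin
    x      ≤⟨ x≤x+y 0≤y ⟩
    x + y  ≈⟨ x+y≈0 ⟩
    0#     ≤⟨ 0≤y ⟩
    y      ∎
  ... | no x+y≉0  = *-cancelʳ-≤ (0≤∧≉⇒0< (0≤x+y (≤-trans 0≤y y≤x) 0≤y) x+y≉0) (begin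
    x * (x + y)    ≈⟨ solve 2 (λ x y → x :* (x :+ y) := x :* x :+ x :* y) refl x y ⟩
    x * x + x * y  ≤⟨ +-mono-≤ xx≤yy ≤-refl ⟩
    y * y + x * y  ≈⟨ solve 2 (λ x y → y :* y :+ x :* y := y :* (x :+ y)) refl x y ⟩
    y * (x + y)    ∎)

  x*x≈y*y⇒x≈y : 0# ≤ x → 0# ≤ y → x * x ≈ y * y → x ≈ y
  x*x≈y*y⇒x≈y 0≤x 0≤y eq =
    antisym (x*x≤y*y⇒x≤y 0≤y (≤-reflexive eq)) (x*x≤y*y⇒x≤y 0≤x (≤-reflexive (sym eq)))

  0≤x^n : 0# ≤ x → ∀ n → 0# ≤ x ^ n
  0≤x^n 0≤x zero    = 0≤1
  0≤x^n 0≤x (suc n) = *-nonNeg 0≤x (0≤x^n 0≤x n)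

  ^-mono-≤ : 0# ≤ x → x ≤ y → ∀ n → x ^ n ≤ y ^ n
  ^-mono-≤ 0≤x x≤y zero    = ≤-refl
  ^-mono-≤ 0≤x x≤y (suc n) = *-mono-≤ (≤-trans 0≤x x≤y) (0≤x^n 0≤x n) x≤y (^-mono-≤ 0≤x x≤y n)

  0≤fromℕ : ∀ n → 0# ≤ fromℕ n
  0≤fromℕ zero    = ≤-refl
  0≤fromℕ (suc n) = 0≤x+y 0≤1 (0≤fromℕ n)

  1≤fromℕ : ∀ n → 1# ≤ fromℕ (suc n)
  1≤fromℕ n = x≤x+y (0≤fromℕ n)

  0<fromℕ : ∀ n → 0# < fromℕ (suc n)
  0<fromℕ n = <-≤-trans 0<1 (1≤fromℕ n)

  ∣∣<1⇒≡0 : ∀ i → fromℕ ℤ.∣ i ∣ < 1# → i ≡ + 0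
  ∣∣<1⇒≡0 (+ zero)  _   = ≡.refl
  ∣∣<1⇒≡0 (+ suc n) n<1 = contradiction (1≤fromℕ n) (<⇒≱ n<1)
  ∣∣<1⇒≡0 -[1+ n ]  n<1 = contradiction (1≤fromℕ n) (<⇒≱ n<1)

  sum-mono-≤ : ∀ n {x y : Vector Carrier n} → (∀ i → x i ≤ y i) → sum x ≤ sum y
  sum-mono-≤ zero    x≤y = ≤-refl
  sum-mono-≤ (suc n) x≤y = +-mono-≤ (x≤y zero) (sum-mono-≤ n (x≤y ∘ suc))

  0≤product : ∀ n {x : Vector Carrier n} → (∀ i → 0# ≤ x i) → 0# ≤ product x
  0≤product zero    0≤x = 0≤1
  0≤product (suc n) 0≤x = *-nonNeg (0≤x zero) (0≤product n (0≤x ∘ suc))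

  0<product : ∀ n {x : Vector Carrier n} → (∀ i → 0# < x i) → 0# < product x
  0<product zero    0<x = 0<1
  0<product (suc n) 0<x = 0<x*y (0<x zero) (0<product n (0<x ∘ suc))

  ^≤product : ∀ n {x : Vector Carrier n} → 0# ≤ y → (∀ i → y ≤ x i) → y ^ n ≤ product x
  ^≤product zero    0≤y y≤x = ≤-refl
  ^≤product (suc n) 0≤y y≤x =
    *-mono-≤ (≤-trans 0≤y (y≤x zero)) (0≤x^n 0≤y n) (y≤x zero) (^≤product n 0≤y (y≤x ∘ suc))

  product≤^ : ∀ n {x : Vector Carrier n} → (∀ i → 0# ≤ x i) → (∀ i → x i ≤ y) → product x ≤ y ^ n
  product≤^ zero    0≤x x≤y = ≤-refl
  product≤^ (suc n) 0≤x x≤y =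
    *-mono-≤ (≤-trans (0≤x zero) (x≤y zero)) (0≤product n (0≤x ∘ suc)) (x≤y zero) (product≤^ n (0≤x ∘ suc) (x≤y ∘ suc))

  product-*-^≤product : ∀ n {x z : Vector Carrier n} → 0# ≤ y → (∀ i → 0# ≤ x i) →
    (∀ i → x i * y ≤ z i) → product x * y ^ n ≤ product z
  product-*-^≤product zero            0≤y 0≤x xy≤z = ≤-reflexive (*-identityˡ 1#)
  product-*-^≤product {y} (suc n) {x} {z} 0≤y 0≤x xy≤z = begin
    x zero * p * (y * y ^ n)   ≈⟨ solve 4 (λ x p y q → x :* p :* (y :* q) := (x :* y) :* (p :* q)) refl (x zero) p y (y ^ n) ⟩
    (x zero * y) * (p * y ^ n) ≤⟨ *-mono-≤ (≤-trans (*-nonNeg (0≤x zero) 0≤y) (xy≤z zero))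
                                    (*-nonNeg (0≤product n (0≤x ∘ suc)) (0≤x^n 0≤y n))
                                    (xy≤z zero) (product-*-^≤product n 0≤y (0≤x ∘ suc) (xy≤z ∘ suc)) ⟩
    product z ∎
    where p = product (tail x)

  0≤allExcept : ∀ {n} (i : Fin n) {x : Vector Carrier n} → (∀ j → 0# ≤ x j) → ∀ j → 0# ≤ allExcept 1# i x j
  0≤allExcept i 0≤x j with j Fin.≟ i
  ... | yes _ = 0≤1
  ... | no  _ = 0≤x j

  -- The factor `z i` is kept and each of the other n - 1 factors is replaced by its lower bound.
  -- Applied with x = c_hji, y = |Y| and z = |β^(hj)|.
  allExcept-product≤product : ∀ n (i : Fin n) (x z : Vector Carrier n) → 0# ≤ y → (∀ j → 0# ≤ x j) →
    (∀ j → 0# ≤ z j) → (∀ j → j ≢ i → x j * y ≤ z j) →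
    product (allExcept 1# i x) * y ^ (n ℕ.∸ 1) * z i ≤ product z
  allExcept-product≤product {y} (suc n) zero x z 0≤y 0≤x 0≤z xy≤z = begin
    1# * product (tail x) * y ^ n * z zero ≈⟨ solve 3 (λ p q z → con (+ 1) :* p :* q :* z := z :* (p :* q)) refl (product (tail x)) (y ^ n) (z zero) ⟩
    z zero * (product (tail x) * y ^ n)    ≤⟨ *-monoʳ-≤ (0≤z zero) (product-*-^≤product n 0≤y (0≤x ∘ suc) λ i → xy≤z (suc i) λ ()) ⟩
    product z                              ∎
  -- An index `suc i` means at least two factors, so the exponent is a successor and one `y` can go
  -- with `x zero`.
  allExcept-product≤product {y} (suc (suc n)) (suc i) x z 0≤y 0≤x 0≤z xy≤z = begin
    x zero * p * (y * y ^ n) * z (suc i)    ≈⟨ solve 5 (λ x p y q z → x :* p :* (y :* q) :* z := (x :* y) :* (p :* q :* z)) refl (x zero) p y (y ^ n) (z (suc i)) ⟩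
    (x zero * y) * (p * y ^ n * z (suc i))  ≤⟨ *-mono-≤ (0≤z zero)
                                                 (*-nonNeg (*-nonNeg (0≤product (suc n) (0≤allExcept i (0≤x ∘ suc))) (0≤x^n 0≤y n)) (0≤z (suc i)))
                                                 (xy≤z zero λ ())
                                                 (allExcept-product≤product (suc n) i (tail x) (tail z) 0≤y (0≤x ∘ suc) (0≤z ∘ suc)
                                                   λ j j≢i → xy≤z (suc j) (j≢i ∘ Fin.suc-injective)) ⟩
    product z                               ∎
    where p = product (allExcept 1# i (tail x))

  allExcept-other : ∀ {n} y (x : Vector Carrier n) {i j} → j ≢ i → allExcept y i x j ≡ x j
  allExcept-other y x {i} {j} j≢i with j Fin.≟ i
  ... | yes j≡i = contradiction j≡i j≢i
  ... | no  _   = ≡.refl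

  0<allExcept-product : ∀ n (i : Fin n) (x : Vector Carrier n) → (∀ j → j ≢ i → 0# < x j) →
                        0# < product (allExcept 1# i x)
  0<allExcept-product n i x 0<x = 0<product n positive
    where
    positive : ∀ j → 0# < allExcept 1# i x j
    positive j with j Fin.≟ i
    ... | yes _  = 0<1
    ... | no j≢i = 0<x j j≢i

  ≤maximum : ∀ {n} (x : Vector Carrier n) i → x i ≤ maximum x
  ≤maximum x zero    = x≤x⊔y _ _
  ≤maximum x (suc i) = ≤-trans (≤maximum (tail x) i) (x≤y⊔x _ _)

  maximum≤ : ∀ {n} (x : Vector Carrier n) → 0# ≤ y → (∀ i → x i ≤ y) → maximum x ≤ y
  maximum≤ {n = zero}  x 0≤y x≤y = 0≤y
  maximum≤ {n = suc n} x 0≤y x≤y = ⊔-lub (x≤y zero) (maximum≤ (tail x) 0≤y (x≤y ∘ suc))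

  -- `maximum` has `0#` as an extra term; a positive maximum cannot come from it and is attained by
  -- the family.
  argmax : ∀ n (x : Vector Carrier n) → 0# < maximum x → ∃ λ i → maximum x ≈ x i
  argmax zero    x 0<0 = contradiction refl (proj₂ 0<0)
  argmax (suc n) x 0<m with ⊔-sel (x zero) (maximum (tail x))
  ... | inj₁ m≈x₀ = zero , m≈x₀
  ... | inj₂ m≈m′ with argmax n (tail x) (<-≤-trans 0<m (≤-reflexive m≈m′))
  ... | i , m′≈xᵢ = suc i , trans m≈m′ m′≈xᵢ

  argmin : ∀ n (x : Vector Carrier (suc n)) → ∃ λ i → ∀ j → x i ≤ x j
  argmin zero    x = zero , λ { zero → ≤-refl }
  argmin (suc n) x with argmin n (tail x)
  ... | i , xᵢ≤ with total (x zero) (x (suc i))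
  ... | inj₁ x₀≤xᵢ = zero , λ { zero → ≤-refl ; (suc j) → ≤-trans x₀≤xᵢ (xᵢ≤ j) }
  ... | inj₂ xᵢ≤x₀ = suc i , λ { zero → xᵢ≤x₀ ; (suc j) → xᵢ≤ j }

  fromℕ-maxℕ≤ : ∀ n (a : Vector ℕ n) → 0# ≤ y → (∀ i → fromℕ (a i) ≤ y) → fromℕ (maxℕ a) ≤ y
  fromℕ-⊔≤ : ∀ a b → fromℕ a ≤ y → fromℕ b ≤ y → fromℕ (a ℕ.⊔ b) ≤ y
  fromℕ-⊔≤ a b a≤y b≤y with ℕ.⊔-sel a b
  ... | inj₁ eq = ≤-trans (≤-reflexive (reflexive (≡.cong fromℕ eq))) a≤y
  ... | inj₂ eq = ≤-trans (≤-reflexive (reflexive (≡.cong fromℕ eq))) b≤y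
  fromℕ-maxℕ≤ zero    a 0≤y a≤y = 0≤y
  fromℕ-maxℕ≤ (suc n) a 0≤y a≤y = fromℕ-⊔≤ (a zero) _ (a≤y zero) (fromℕ-maxℕ≤ n (tail a) 0≤y (a≤y ∘ suc))

  -- The powers of 2 are unbounded: halving a least upper bound would give a smaller one.
  2^n-unbounded : ¬ (∀ n → fromℕ 2 ^ n ≤ y)
  -- The downward closure of the powers has the same upper bounds as the powers, and being stated
  -- with `≤` it lies at the level `ℓ₃` at which `supremum` takes its predicates.
  2^n-unbounded {y} bounded with supremum (λ t → ∃ λ n → t ≤ fromℕ 2 ^ n) (1# , 0 , ≤-refl)
                                         (y , λ { (n , t≤) → ≤-trans t≤ (bounded n) })
  ... | s , upper , least = <⇒≱ 0<1 (begin
    1#              ≤⟨ upper (0 , ≤-refl) ⟩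
    s               ≈⟨ solve 1 (λ s → s := s :+ s :+ :- s) refl s ⟩
    s + s + - s     ≤⟨ +-mono-≤ s+s≤s ≤-refl ⟩
    s - s           ≈⟨ -‿inverseʳ s ⟩
    0#              ∎)
    where
    half = fromℕ 2 ⁻¹

    double-half : ∀ t → t * half + t * half ≈ t
    double-half t = trans (solve 2 (λ t h → t :* h :+ t :* h := t :* ((con (+ 1) :+ (con (+ 1) :+ con (+ 0))) :* h)) refl t half)
      (trans (*-congˡ (*-inverseʳ (0<⇒≉ (0<fromℕ 1)))) (*-identityʳ t))

    s/2-upper : IsUpperBound (λ t → ∃ λ n → t ≤ fromℕ 2 ^ n) (s * half)
    s/2-upper {t} (n , t≤2^n) = ≤-trans t≤2^n (*-cancelʳ-≤ (0<fromℕ 1) (begin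
      fromℕ 2 ^ n * fromℕ 2    ≈⟨ *-comm _ _ ⟩
      fromℕ 2 ^ suc n          ≤⟨ upper (suc n , ≤-refl) ⟩
      s                        ≈⟨ trans (*-assoc s half _) (trans (*-congˡ (trans (*-comm half _) (*-inverseʳ (0<⇒≉ (0<fromℕ 1))))) (*-identityʳ s)) ⟨
      s * half * fromℕ 2       ∎))

    s+s≤s : s + s ≤ s
    s+s≤s = ≤-trans (+-mono-≤ s≤s/2 s≤s/2) (≤-reflexive (double-half s))
      where s≤s/2 = least (s * half) s/2-upper

  -- Multiplying 1 ≤ y q^n by 2^n would give 2^n ≤ y (2q)^n ≤ y for all n.
  archimedean : ∀ {q} → 0# ≤ q → 0# ≤ y → fromℕ 2 * q ≤ 1# → ¬ (∀ n → 1# ≤ y * q ^ n)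
  archimedean {y} {q} 0≤q 0≤y 2q≤1 bounded = 2^n-unbounded λ n → begin
    fromℕ 2 ^ n                ≈⟨ *-identityʳ _ ⟨
    fromℕ 2 ^ n * 1#           ≤⟨ *-monoʳ-≤ (0≤x^n (0≤fromℕ 2) n) (bounded n) ⟩
    fromℕ 2 ^ n * (y * q ^ n)  ≈⟨ solve 3 (λ t y p → t :* (y :* p) := y :* (t :* p)) refl _ y (q ^ n) ⟩
    y * (fromℕ 2 ^ n * q ^ n)  ≈⟨ *-congˡ (^-distrib-* (fromℕ 2) q n) ⟨
    y * (fromℕ 2 * q) ^ n      ≤⟨ *-monoʳ-≤ 0≤y (^-mono-≤ (*-nonNeg (0≤fromℕ 2) 0≤q) 2q≤1 n) ⟩
    y * 1# ^ n                 ≈⟨ *-congˡ (1^n≈1 n) ⟩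
    y * 1#                     ≈⟨ *-identityʳ y ⟩
    y                          ∎

  module _ (n : ℕ) .{{_ : NonZero n}} (x : Carrier) (0≤x : 0# ≤ x) where
    -- The two halves of the definition of `root` as a supremum. The n-th roots of |μ| are compared
    -- with |β^(hi)| through `≤root`; `root≤` serves the square root in `∣_∣`.
    ≤root : ∀ {y} → 0# ≤ y → y ^ n ≤ x → y ≤ root n x 0≤x
    ≤root 0≤y y^n≤x = proj₁ (proj₂ (supremum (RootBelow n x 0≤x) (0# , 0-RootBelow n x 0≤x)
      (1# + x , RootBelow-bounded n x 0≤x))) (0≤y , y^n≤x)

    root≤ : ∀ {u} → (∀ {y} → 0# ≤ y → y ^ n ≤ x → y ≤ u) → root n x 0≤x ≤ u
    root≤ {u} bound = proj₂ (proj₂ (supremum (RootBelow n x 0≤x) (0# , 0-RootBelow n x 0≤x)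
      (1# + x , RootBelow-bounded n x 0≤x))) u (λ { (0≤y , y^n≤x) → bound 0≤y y^n≤x })

  x^2≈x*x : ∀ x → x ^ 2 ≈ x * x
  x^2≈x*x x = *-congˡ (*-identityʳ x)

  -- Through this, claims about `∣_∣` become polynomial identities and inequalities in real and
  -- imaginary parts.
  root2-squared : ∀ x (0≤x : 0# ≤ x) → root 2 x 0≤x * root 2 x 0≤x ≈ x
  root2-squared x 0≤x = antisym s²≤x x≤s²
    where
    s = root 2 x 0≤x
    0≤s = 0≤root 2 x 0≤x

    -- By AM-GM, (s² + x) / 2s is an upper bound for the square root of x.
    s²≤x : s * s ≤ x
    s²≤x with s ≈? 0#
    ... | yes s≈0 = ≤-trans (≤-reflexive (trans (*-congʳ s≈0) (zeroˡ s))) 0≤x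
    ... | no  s≉0 = 0≤y-x⇒x≤y (begin
      0#                                  ≤⟨ x≤y⇒0≤y-x s*2s≤s²+x ⟩
      (s * s + x) - s * (s + s)           ≈⟨ solve 2 (λ s x → (s :* s :+ x) :- s :* (s :+ s) := x :- s :* s) refl s x ⟩
      x - s * s                           ∎)
      where
      0<2s : 0# < s + s
      0<2s = <-≤-trans (0≤∧≉⇒0< 0≤s s≉0) (x≤x+y 0≤s)

      undo : ∀ t → t * (s + s) ⁻¹ * (s + s) ≈ t
      undo t = trans (*-assoc t _ _) (trans (*-congˡ (trans (*-comm _ _) (*-inverseʳ (0<⇒≉ 0<2s)))) (*-identityʳ t))

      s≤u : s ≤ (s * s + x) * (s + s) ⁻¹
      s≤u = root≤ 2 x 0≤x λ {y} 0≤y y²≤x → *-cancelʳ-≤ 0<2s (begin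
        y * (s + s)                             ≈⟨ solve 2 (λ y s → y :* (s :+ s) := (s :* s :+ y :* y) :- (s :- y) :* (s :- y)) refl y s ⟩
        (s * s + y * y) - (s - y) * (s - y)     ≤⟨ 0≤y-x⇒x≤y (≤-trans (0≤x*x (s - y)) (≤-reflexive
                                                     (solve 2 (λ a b → b :* b := a :- (a :- b :* b)) refl (s * s + y * y) (s - y)))) ⟩
        s * s + y * y                           ≤⟨ +-monoʳ-≤ (s * s) (≤-trans (≤-reflexive (sym (x^2≈x*x y))) y²≤x) ⟩
        s * s + x                               ≈⟨ undo _ ⟨
        (s * s + x) * (s + s) ⁻¹ * (s + s)      ∎)

      s*2s≤s²+x : s * (s + s) ≤ s * s + x
      s*2s≤s²+x = ≤-trans (*-monoˡ-≤ (proj₁ 0<2s) s≤u) (≤-reflexive (undo _))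

    -- If d = x - s² ≥ 0 then s + d / (1 + 2s + d) is still below the square root of x.
    x≤s² : x ≤ s * s
    x≤s² with total x (s * s)
    ... | inj₁ x≤s² = x≤s²
    ... | inj₂ s²≤x = 0≤y-x⇒x≤y (begin
      0#                      ≈⟨ zeroˡ v ⟨
      0# * v                  ≤⟨ *-monoˡ-≤ (proj₁ 0<v) 0≤-ε ⟩
      - ε * v                 ≈⟨ solve 2 (λ e v → :- e :* v := :- (e :* v)) refl ε v ⟩
      - (ε * v)               ≈⟨ -‿cong ε*v≈d ⟩
      - (x - s * s)           ≈⟨ solve 2 (λ x s → :- (x :- s) := s :- x) refl x (s * s) ⟩
      s * s - x               ∎)
      where
      d = x - s * s
      0≤d = x≤y⇒0≤y-x s²≤x
      v = 1# + ((s + s) + d)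

      0<v : 0# < v
      0<v = <-≤-trans 0<1 (x≤x+y (0≤x+y (0≤x+y 0≤s 0≤s) 0≤d))

      ε = d * v ⁻¹

      0≤ε : 0# ≤ ε
      0≤ε = *-nonNeg 0≤d (0≤x⁻¹ 0<v)

      ε*v≈d : ε * v ≈ d
      ε*v≈d = trans (*-assoc d _ _) (trans (*-congˡ (trans (*-comm _ _) (*-inverseʳ (0<⇒≉ 0<v)))) (*-identityʳ d))

      ε≤1 : ε ≤ 1#
      ε≤1 = *-cancelʳ-≤ 0<v (begin
        ε * v              ≈⟨ ε*v≈d ⟩
        d                  ≤⟨ x≤x+y (0≤x+y 0≤1 (0≤x+y 0≤s 0≤s)) ⟩
        d + (1# + (s + s)) ≈⟨ solve 2 (λ d s → d :+ (con (+ 1) :+ (s :+ s)) := con (+ 1) :* (con (+ 1) :+ ((s :+ s) :+ d))) refl d s ⟩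
        1# * v             ∎)

      s+ε≤s : s + ε ≤ s
      s+ε≤s = ≤root 2 x 0≤x (0≤x+y 0≤s 0≤ε) (begin
        (s + ε) ^ 2                        ≈⟨ x^2≈x*x (s + ε) ⟩
        (s + ε) * (s + ε)                  ≈⟨ solve 2 (λ s e → (s :+ e) :* (s :+ e) := s :* s :+ e :* (s :+ s :+ e)) refl s ε ⟩
        s * s + ε * (s + s + ε)            ≤⟨ +-monoʳ-≤ (s * s) (*-monoʳ-≤ 0≤ε (begin
          s + s + ε     ≤⟨ +-monoʳ-≤ (s + s) (≤-trans ε≤1 (x≤x+y 0≤d)) ⟩
          s + s + (1# + d)  ≈⟨ solve 2 (λ s d → s :+ s :+ (con (+ 1) :+ d) := con (+ 1) :+ ((s :+ s) :+ d)) refl s d ⟩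
          v             ∎)) ⟩
        s * s + ε * v                      ≈⟨ +-congˡ ε*v≈d ⟩
        s * s + (x - s * s)                ≈⟨ solve 2 (λ s x → s :+ (x :- s) := x) refl (s * s) x ⟩
        x                                  ∎)

      0≤-ε : 0# ≤ - ε
      0≤-ε = ≤-trans (x≤y⇒0≤y-x s+ε≤s) (≤-reflexive (solve 2 (λ s e → s :- (s :+ e) := :- e) refl s ε))

-- The complex numbers as a commutative ring, and their absolute value.

module ComplexNumbers {r ℓ₁ ℓ₂ ℓ₃} (ℝ : CompleteOrderedField r ℓ₁ ℓ₂ ℓ₃) where
  open CompleteOrderedField ℝ hiding (zero)
  open Reals ℝ
  open OrderedField ℝ
  open IntegerCoefficients commutativeRing
  open RawRing ℂ using () renaming (_*_ to _*ᶜ_; 1# to 1ᶜ)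
  open RawRingDefs ℂ using () renaming (fromℕ to fromℕᶜ; fromℤ to fromℤᶜ; sum to sumᶜ; product to productᶜ; _^_ to _^ᶜ_)
  open PosetReasoning poset

  ℂ-isCommutativeRing : IsCommutativeRing _≈ᶜ_ _+ᶜ_ _*ᶜ_ -ᶜ_ 0ᶜ 1ᶜ
  ℂ-isCommutativeRing = record
    { isRing = record
      { +-isAbelianGroup = record
        { isGroup = record
          { isMonoid = record
            { isSemigroup = record
              { isMagma = record
                { isEquivalence = record
                  { refl  = refl , refl
                  ; sym   = λ (p , q) → sym p , sym q
                  ; trans = λ (p , q) (p′ , q′) → trans p p′ , trans q q′
                  }
                ; ∙-cong = λ (p , q) (p′ , q′) → +-cong p p′ , +-cong q q′
                }
              ; assoc = λ (a , b) (c , d) (e , f) → +-assoc a c e , +-assoc b d f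
              }
            ; identity = (λ (a , b) → +-identityˡ a , +-identityˡ b)
                       , (λ (a , b) → +-identityʳ a , +-identityʳ b)
            }
          ; inverse = (λ (a , b) → -‿inverseˡ a , -‿inverseˡ b)
                    , (λ (a , b) → -‿inverseʳ a , -‿inverseʳ b)
          ; ⁻¹-cong = λ (p , q) → -‿cong p , -‿cong q
          }
        ; comm = λ (a , b) (c , d) → +-comm a c , +-comm b d
        }
      ; *-cong = λ (p , q) (p′ , q′) → +-cong (*-cong p p′) (-‿cong (*-cong q q′))
                                     , +-cong (*-cong p q′) (*-cong q p′)
      ; *-assoc = λ (a , b) (c , d) (e , f) →
          solve 6 (λ a b c d e f → (a :* c :- b :* d) :* e :- (a :* d :+ b :* c) :* f
                                 := a :* (c :* e :- d :* f) :- b :* (c :* f :+ d :* e)) refl a b c d e f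
        , solve 6 (λ a b c d e f → (a :* c :- b :* d) :* f :+ (a :* d :+ b :* c) :* e
                                 := a :* (c :* f :+ d :* e) :+ b :* (c :* e :- d :* f)) refl a b c d e f
      ; *-identity = (λ (a , b) → solve 2 (λ a b → con (+ 1) :* a :- con (+ 0) :* b := a) refl a b
                                , solve 2 (λ a b → con (+ 1) :* b :+ con (+ 0) :* a := b) refl a b)
                   , (λ (a , b) → solve 2 (λ a b → a :* con (+ 1) :- b :* con (+ 0) := a) refl a b
                                , solve 2 (λ a b → a :* con (+ 0) :+ b :* con (+ 1) := b) refl a b)
      ; distrib = (λ (a , b) (c , d) (e , f) →
            solve 6 (λ a b c d e f → a :* (c :+ e) :- b :* (d :+ f) := (a :* c :- b :* d) :+ (a :* e :- b :* f)) refl a b c d e f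
          , solve 6 (λ a b c d e f → a :* (d :+ f) :+ b :* (c :+ e) := (a :* d :+ b :* c) :+ (a :* f :+ b :* e)) refl a b c d e f)
        , (λ (a , b) (c , d) (e , f) →
            solve 6 (λ a b c d e f → (c :+ e) :* a :- (d :+ f) :* b := (c :* a :- d :* b) :+ (e :* a :- f :* b)) refl a b c d e f
          , solve 6 (λ a b c d e f → (c :+ e) :* b :+ (d :+ f) :* a := (c :* b :+ d :* a) :+ (e :* b :+ f :* a)) refl a b c d e f)
      }
    ; *-comm = λ (a , b) (c , d) → solve 4 (λ a b c d → a :* c :- b :* d := c :* a :- d :* b) refl a b c d
                                 , solve 4 (λ a b c d → a :* d :+ b :* c := c :* b :+ d :* a) refl a b c d
    }

  ℂ-commutativeRing : CommutativeRing r ℓ₁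
  ℂ-commutativeRing = record { isCommutativeRing = ℂ-isCommutativeRing }

  module ℂ where
    open CommutativeRing ℂ-commutativeRing public hiding (zero)
    open RingLemmas ℂ-commutativeRing public

  private
    variable
      z w : Complex

  normSq : Complex → Carrier
  normSq z = proj₁ z * proj₁ z + proj₂ z * proj₂ z

  0≤normSq : ∀ z → 0# ≤ normSq z
  0≤normSq z = 0≤x+y (0≤x*x (proj₁ z)) (0≤x*x (proj₂ z))

  ∣∣-squared : ∀ z → ∣ z ∣ * ∣ z ∣ ≈ normSq z
  ∣∣-squared z = root2-squared (normSq z) (0≤normSq z)

  ∣∣-unique : ∀ {x} → 0# ≤ x → x * x ≈ normSq z → ∣ z ∣ ≈ x
  ∣∣-unique {z} 0≤x x²≈ = x*x≈y*y⇒x≈y 0≤∣ z ∣ 0≤x (trans (∣∣-squared z) (sym x²≈))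

  ∣∣-cong : z ≈ᶜ w → ∣ z ∣ ≈ ∣ w ∣
  ∣∣-cong {z} {w} (p , q) = ∣∣-unique 0≤∣ w ∣ (trans (∣∣-squared w)
    (sym (+-cong (*-cong p p) (*-cong q q))))

  ∣0∣≈0 : ∣ 0ᶜ ∣ ≈ 0#
  ∣0∣≈0 = ∣∣-unique ≤-refl (sym (trans (+-congˡ (zeroˡ 0#)) (+-identityʳ _)))

  ∣1∣≈1 : ∣ 1ᶜ ∣ ≈ 1#
  ∣1∣≈1 = ∣∣-unique 0≤1 (sym (trans (+-congˡ (zeroˡ 0#)) (+-identityʳ _)))

  ∣-∣ : ∀ z → ∣ -ᶜ z ∣ ≈ ∣ z ∣
  ∣-∣ z@(a , b) = ∣∣-unique 0≤∣ z ∣ (trans (∣∣-squared z)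
    (solve 2 (λ a b → a :* a :+ b :* b := (:- a) :* (:- a) :+ (:- b) :* (:- b)) refl a b))

  ∣∣≈0⇒≈0 : ∣ z ∣ ≈ 0# → z ≈ᶜ 0ᶜ
  ∣∣≈0⇒≈0 {z@(a , b)} eq = square-zero (x≤x+y (0≤x*x b)) , square-zero (≤-trans (x≤x+y (0≤x*x a)) (≤-reflexive (+-comm _ _)))
    where
    normSq≈0 : normSq z ≈ 0#
    normSq≈0 = trans (sym (∣∣-squared z)) (trans (*-congʳ eq) (zeroˡ _))

    square-zero : ∀ {x} → x * x ≤ normSq z → x ≈ 0#
    square-zero {x} x²≤ = x*x≈0⇒x≈0 (antisym (≤-trans x²≤ (≤-reflexive normSq≈0)) (0≤x*x x))

  -- Brahmagupta's two-square identity.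
  ∣*∣ : ∀ z w → ∣ z *ᶜ w ∣ ≈ ∣ z ∣ * ∣ w ∣
  ∣*∣ z@(a , b) w@(c , d) = ∣∣-unique (*-nonNeg 0≤∣ z ∣ 0≤∣ w ∣) (begin-equality
    ∣ z ∣ * ∣ w ∣ * (∣ z ∣ * ∣ w ∣)        ≈⟨ solve 2 (λ x y → x :* y :* (x :* y) := (x :* x) :* (y :* y)) refl ∣ z ∣ ∣ w ∣ ⟩
    (∣ z ∣ * ∣ z ∣) * (∣ w ∣ * ∣ w ∣)      ≈⟨ *-cong (∣∣-squared z) (∣∣-squared w) ⟩
    normSq z * normSq w                  ≈⟨ solve 4 (λ a b c d → (a :* a :+ b :* b) :* (c :* c :+ d :* d) :=
                                              (a :* c :- b :* d) :* (a :* c :- b :* d) :+ (a :* d :+ b :* c) :* (a :* d :+ b :* c)) refl a b c d ⟩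
    normSq (z *ᶜ w)                      ∎)

  -- Lagrange's identity: the squares of the two sides differ by (ad - bc)².
  cauchy-schwarz : ∀ z w → proj₁ z * proj₁ w + proj₂ z * proj₂ w ≤ ∣ z ∣ * ∣ w ∣
  cauchy-schwarz z@(a , b) w@(c , d) = x*x≤y*y⇒x≤y (*-nonNeg 0≤∣ z ∣ 0≤∣ w ∣) (begin
    (a * c + b * d) * (a * c + b * d)    ≤⟨ x≤x+y (0≤x*x (a * d - b * c)) ⟩
    (a * c + b * d) * (a * c + b * d) + (a * d - b * c) * (a * d - b * c)
                                         ≈⟨ solve 4 (λ a b c d → (a :* c :+ b :* d) :* (a :* c :+ b :* d) :+ (a :* d :- b :* c) :* (a :* d :- b :* c)
                                              := (a :* a :+ b :* b) :* (c :* c :+ d :* d)) refl a b c d ⟩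
    normSq z * normSq w                  ≈⟨ *-cong (∣∣-squared z) (∣∣-squared w) ⟨
    (∣ z ∣ * ∣ z ∣) * (∣ w ∣ * ∣ w ∣)      ≈⟨ solve 2 (λ x y → x :* y :* (x :* y) := (x :* x) :* (y :* y)) refl ∣ z ∣ ∣ w ∣ ⟨
    ∣ z ∣ * ∣ w ∣ * (∣ z ∣ * ∣ w ∣)        ∎)

  ∣+∣≤ : ∀ z w → ∣ z +ᶜ w ∣ ≤ ∣ z ∣ + ∣ w ∣
  ∣+∣≤ z@(a , b) w@(c , d) = x*x≤y*y⇒x≤y (0≤x+y 0≤∣ z ∣ 0≤∣ w ∣) (begin
    ∣ z +ᶜ w ∣ * ∣ z +ᶜ w ∣                            ≈⟨ ∣∣-squared (z +ᶜ w) ⟩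
    normSq (z +ᶜ w)                                  ≈⟨ solve 4 (λ a b c d → (a :+ c) :* (a :+ c) :+ (b :+ d) :* (b :+ d) :=
                                                          ((a :* a :+ b :* b) :+ (c :* c :+ d :* d)) :+ ((a :* c :+ b :* d) :+ (a :* c :+ b :* d))) refl a b c d ⟩
    (normSq z + normSq w) + ((a * c + b * d) + (a * c + b * d))
                                                     ≤⟨ +-mono-≤ (≤-reflexive (sym (+-cong (∣∣-squared z) (∣∣-squared w))))
                                                          (+-mono-≤ (cauchy-schwarz z w) (cauchy-schwarz z w)) ⟩
    (∣ z ∣ * ∣ z ∣ + ∣ w ∣ * ∣ w ∣) + (∣ z ∣ * ∣ w ∣ + ∣ z ∣ * ∣ w ∣)
                                                     ≈⟨ solve 2 (λ x y → (x :* x :+ y :* y) :+ (x :* y :+ x :* y) := (x :+ y) :* (x :+ y)) refl ∣ z ∣ ∣ w ∣ ⟩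
    (∣ z ∣ + ∣ w ∣) * (∣ z ∣ + ∣ w ∣)                    ∎)

  ∣product∣ : ∀ n (z : Vector Complex n) → ∣ productᶜ z ∣ ≈ product (λ i → ∣ z i ∣)
  ∣product∣ zero    z = ∣1∣≈1
  ∣product∣ (suc n) z = trans (∣*∣ (z zero) (productᶜ (tail z))) (*-congˡ (∣product∣ n (tail z)))

  ∣^∣ : ∀ z n → ∣ z ^ᶜ n ∣ ≈ ∣ z ∣ ^ n
  ∣^∣ z zero    = ∣1∣≈1
  ∣^∣ z (suc n) = trans (∣*∣ z (z ^ᶜ n)) (*-congˡ (∣^∣ z n))

  ∣sum∣≤ : ∀ n (z : Vector Complex n) → ∣ sumᶜ z ∣ ≤ sum (λ i → ∣ z i ∣)
  ∣sum∣≤ zero    z = ≤-reflexive ∣0∣≈0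
  ∣sum∣≤ (suc n) z = ≤-trans (∣+∣≤ (z zero) (sumᶜ (tail z))) (+-monoʳ-≤ ∣ z zero ∣ (∣sum∣≤ n (tail z)))

  fromℕᶜ≈ : ∀ n → fromℕᶜ n ≈ᶜ (fromℕ n , 0#)
  fromℕᶜ≈ zero    = refl , refl
  fromℕᶜ≈ (suc n) = +-congˡ (proj₁ (fromℕᶜ≈ n)) , trans (+-identityˡ _) (proj₂ (fromℕᶜ≈ n))

  ∣fromℕ∣ : ∀ n → ∣ fromℕᶜ n ∣ ≈ fromℕ n
  ∣fromℕ∣ n = ∣∣-unique (0≤fromℕ n) (sym (trans (+-cong (*-cong p p) (trans (*-congʳ q) (zeroˡ _))) (+-identityʳ _)))
    where
    p = proj₁ (fromℕᶜ≈ n)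
    q = proj₂ (fromℕᶜ≈ n)

  ∣fromℤ∣ : ∀ i → ∣ fromℤᶜ i ∣ ≈ fromℕ ℤ.∣ i ∣
  ∣fromℤ∣ (+ n)    = ∣fromℕ∣ n
  ∣fromℤ∣ -[1+ n ] = trans (∣-∣ (fromℕᶜ (suc n))) (∣fromℕ∣ (suc n))

  *ᶜ-cancel-≈0 : z *ᶜ w ≈ᶜ 0ᶜ → ¬ (z ≈ᶜ 0ᶜ) → w ≈ᶜ 0ᶜ
  *ᶜ-cancel-≈0 {z} {w} zw≈0 z≉0 = ∣∣≈0⇒≈0 (*-cancel-≈0
    (trans (sym (∣*∣ z w)) (trans (∣∣-cong zw≈0) ∣0∣≈0)) (z≉0 ∘ ∣∣≈0⇒≈0))

  1ᶜ≉0ᶜ : ¬ (1ᶜ ≈ᶜ 0ᶜ)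
  1ᶜ≉0ᶜ (eq , _) = 1≉0 eq

  0<∣-∣ : ∀ z w → ¬ (z ≈ᶜ w) → 0# < ∣ z +ᶜ -ᶜ w ∣
  0<∣-∣ z w z≉w = 0≤∧≉⇒0< 0≤∣ z +ᶜ -ᶜ w ∣ λ eq → z≉w (x∙y⁻¹≈ε⇒x≈y z w (∣∣≈0⇒≈0 eq))
    where open import Algebra.Properties.AbelianGroup ℂ.+-abelianGroup using (x∙y⁻¹≈ε⇒x≈y)

≤maxℕ : ∀ {n} (a : Vector ℕ n) i → a i ℕ.≤ maxℕ a
≤maxℕ a zero    = ℕ.m≤m⊔n _ _
≤maxℕ a (suc i) = ℕ.≤-trans (≤maxℕ (tail a) i) (ℕ.m≤n⊔m _ _)

-- Solving a linear system with a left inverse.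

module LinearSystem {c ℓ} (R : CommutativeRing c ℓ) where
  open CommutativeRing R hiding (zero)
  open RawRingDefs rawRing
  open RingLemmas R
  open IntegerCoefficients R
  open import Relation.Binary.Reasoning.Setoid setoid
  open Sum semiring using (∑-comm; *-distribˡ-sum; *-distribʳ-sum)

  -- u = (T S) u = T (S u). It recovers integral coordinates from conjugates; the product
  -- `u k * S j k` is in the order of `ℤ-combination`.
  left-inverse-solves : ∀ {n} {T S : Matrix Carrier n} → (∀ i k → (T *ᴹ S) i k ≈ 1ᴹ i k) →
    ∀ {u v : Vector Carrier n} → (∀ j → v j ≈ sum (λ k → u k * S j k)) →
    ∀ i → u i ≈ sum (λ j → T i j * v j)
  left-inverse-solves {n} {T} {S} TS≈1 {u} {v} v≈Su i = begin
    u i                                       ≈⟨ 1ᴹ-sum i u ⟨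
    sum (λ k → 1ᴹ i k * u k)                  ≈⟨ sum-cong n (λ k → *-congʳ {u k} (TS≈1 i k)) ⟨
    sum (λ k → sum (λ j → T i j * S j k) * u k) ≈⟨ sum-cong n (λ k → *-distribʳ-sum {n} (u k) (λ j → T i j * S j k)) ⟩
    sum (λ k → sum (λ j → T i j * S j k * u k)) ≈⟨ ∑-comm {n} {n} (λ k j → T i j * S j k * u k) ⟩
    sum (λ j → sum (λ k → T i j * S j k * u k)) ≈⟨ sum-cong n (λ j → sum-cong n λ k → swap (T i j) (S j k) (u k)) ⟩
    sum (λ j → sum (λ k → T i j * (u k * S j k))) ≈⟨ sum-cong n (λ j → *-distribˡ-sum {n} (T i j) (λ k → u k * S j k)) ⟨
    sum (λ j → T i j * sum (λ k → u k * S j k)) ≈⟨ sum-cong n (λ j → *-congˡ {T i j} (v≈Su j)) ⟨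
    sum (λ j → T i j * v j)                   ∎
    where
    swap = solve 3 (λ t s u → t :* s :* u := t :* (u :* s)) refl

-- Homomorphisms from a field to a nontrivial ring are injective.

module FieldHomomorphism {c ℓ₁ ℓ₂ r ℓ₃} (F : HeytingField c ℓ₁ ℓ₂) (R : CommutativeRing r ℓ₃)
  (1≉0 : ¬ (CommutativeRing._≈_ R (CommutativeRing.1# R) (CommutativeRing.0# R)))
  {φ : HeytingField.Carrier F → CommutativeRing.Carrier R}
  (φ-isHom : IsHom (Field.rawRing F) (CommutativeRing.rawRing R) φ) where
  private
    module F = Field F
  open CommutativeRing R hiding (zero)
  open RingMorphisms.IsRingHomomorphism φ-isHom
  open HeytingProperties F.heytingCommutativeRing using (x-0≈x)

  -- By tightness it is enough to refute `x # 0#`; such an `x` is invertible, and applying φ to x y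
  -- = 1 would give 1 = 0.
  injective : ∀ {x} → φ x ≈ 0# → x F.≈ F.0#
  injective {x} φx≈0 = proj₁ (HeytingField.tight F x F.0#) λ x#0 →
    let y , _ , [x-0]y≈1 = F.#⇒invertible x#0 in
    1≉0 (trans (sym 1#-homo) (trans (⟦⟧-cong (F.trans (F.sym [x-0]y≈1) (F.*-congʳ (x-0≈x x))))
      (trans (*-homo x y) (trans (*-congʳ φx≈0) (zeroˡ _)))))

-- Conjugates in ℂ: product formula, bounds for coordinates, and 2|α| ≥ 1.

module Conjugates
  {r ℓ₁ ℓ₂ ℓ₃ ℓ ℓ₄ ℓ₅ k ℓ₆ ℓ₇} (ℝ : CompleteOrderedField r ℓ₁ ℓ₂ ℓ₃) {m n : ℕ}
  (M : NumberField ℓ ℓ₄ ℓ₅ m) (K : HeytingField k ℓ₆ ℓ₇)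
  {ω : Vector (NumberField.Carrier M) m} (ω-basis : NumberField.IsIntegralBasis M ω)
  {ι : NumberField.Carrier M → Field.Carrier K} (ι-isHom : IsHom (NumberField.rawRing M) (Field.rawRing K) ι)
  {α : Field.Carrier K} (α-integral : Field.IsIntegral K α)
  {f : Vector (NumberField.Carrier M) (suc n)}
  (f-minimal : ExtensionDefs.IsMinimalPolynomial (NumberField.rawRing M) (Field.rawRing K) ι α f)
  {σ : Fin m → NumberField.Carrier M → Reals.Complex ℝ}
  (σ-isHom : ∀ j → IsHom (NumberField.rawRing M) (Reals.ℂ ℝ) (σ j))
  {αᶜ : Fin m → Vector (Reals.Complex ℝ) (suc n)}
  (αᶜ-roots : ∀ j → Reals.IsRoots ℝ (λ i → σ j (f i)) (αᶜ j))
  {τ : Fin m → Fin (suc n) → Field.Carrier K → Reals.Complex ℝ}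
  (τ-isHom : ∀ j i → IsHom (Field.rawRing K) (Reals.ℂ ℝ) (τ j i))
  (τ-ι : ∀ j i γ → Reals._≈ᶜ_ ℝ (τ j i (ι γ)) (σ j γ))
  (τ-α : ∀ j i → Reals._≈ᶜ_ ℝ (τ j i α) (αᶜ j i))
  {T : Matrix (Reals.Complex ℝ) m} (T-inverse : RawRingDefs.IsInverse (Reals.ℂ ℝ) (λ j i → σ j (ω i)) T)
  where

  private
    module M = NumberField M
    module K = Field K
  open Reals ℝ
  open ExtensionDefs M.rawRing K.rawRing ι
  open CompleteOrderedField ℝ hiding (zero)
  open OrderedField ℝ
  open ComplexNumbers ℝ
  open IntegerCoefficients commutativeRing
  open PosetReasoning poset
  open Max totalOrder using (x≤x⊔y)
  open CommutativeExp commutativeSemiring using (^-distrib-*)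
  open RawRing ℂ using () renaming (_*_ to _*ᶜ_)
  open RawRingDefs ℂ using () renaming (fromℤ to fromℤᶜ; sum to sumᶜ; product to productᶜ; IsIntegral to IsIntegralᶜ)
  open IsMinimalPolynomial f-minimal using (minimal)
  private
    module FM = BinaryForm M.commutativeRing
    module Fᶜ = BinaryForm ℂ-commutativeRing
    module σ j = RingMorphisms.IsRingHomomorphism (σ-isHom j)
    module τ j i = RingMorphisms.IsRingHomomorphism (τ-isHom j i)
    module σ-injective j = FieldHomomorphism M.heytingField ℂ-commutativeRing 1ᶜ≉0ᶜ (σ-isHom j)
    module τ-injective j i = FieldHomomorphism K ℂ-commutativeRing 1ᶜ≉0ᶜ (τ-isHom j i)
    module σ-homo j = HomomorphismLemmas M.commutativeRing ℂ-commutativeRing (σ-isHom j)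
    module τ-homo j i = HomomorphismLemmas K.commutativeRing ℂ-commutativeRing (τ-isHom j i)
    module σ-form j = NormForm M.commutativeRing ℂ-commutativeRing (σ-isHom j)
    module Iᶜ = Integrality ℂ-commutativeRing
    module IM = Integrality M.commutativeRing

  sizeα : Carrier
  sizeα = maximum (λ h → size (αᶜ h))

  0≤sizeα : 0# ≤ sizeα
  0≤sizeα = 0≤maximum (λ h → size (αᶜ h))

  ∣αᶜ∣≤sizeα : ∀ h i → ∣ αᶜ h i ∣ ≤ sizeα
  ∣αᶜ∣≤sizeα h i = ≤-trans (≤maximum (λ i → ∣ αᶜ h i ∣) i) (≤maximum (λ h → size (αᶜ h)) h)

  linear : M.Carrier → M.Carrier → ∀ h → Vector Complex (suc n)
  linear X Y h i = σ h X +ᶜ -ᶜ (αᶜ h i *ᶜ σ h Y)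

  -- Serves twice: at (X, Y) for the norm of β, and at (0, 1) for the constant term of f.
  form-splits : ∀ h X Y → σ h (FM.form (suc n) f X Y) ≈ᶜ productᶜ (linear X Y h)
  form-splits h X Y = ℂ.trans (σ-form.form-homo h (suc n) f X Y)
    (Fᶜ.form-factorization (λ {x} {y} → *ᶜ-cancel-≈0 {x} {y}) (suc n) (λ i → σ h (f i)) (αᶜ h)
      (IsRoots.isRoot (αᶜ-roots h)) (IsRoots.distinct (αᶜ-roots h)) (σ h X) (σ h Y))

  τ-linear : ∀ h i X Y → τ h i (ι X K.- α K.* ι Y) ≈ᶜ linear X Y h i
  τ-linear h i X Y = ℂ.trans (τ.+-homo h i _ _) (ℂ.+-cong (τ-ι h i X)
    (ℂ.trans (τ.-‿homo h i _) (ℂ.-‿cong (ℂ.trans (τ.*-homo h i _ _) (ℂ.*-cong (τ-α h i) (τ-ι h i Y))))))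

  -- The coordinates are T applied to the vector of conjugates, and the row norm is the operator
  -- norm for the maximum norm.
  coordinate-bound : ∀ {X} (x : Vector ℤ m) → X M.≈ M.ℤ-combination ω x → ∀ {B} → 0# ≤ B →
    (∀ j → ∣ σ j X ∣ ≤ B) → ∀ i → fromℕ ℤ.∣ x i ∣ ≤ rowNorm T * B
  coordinate-bound {X} x X≈ {B} 0≤B ∣X∣≤B i = begin
    fromℕ ℤ.∣ x i ∣                          ≈⟨ ∣fromℤ∣ (x i) ⟨
    ∣ fromℤᶜ (x i) ∣                         ≈⟨ ∣∣-cong (solves i) ⟩
    ∣ sumᶜ (λ j → T i j *ᶜ σ j X) ∣          ≤⟨ ∣sum∣≤ m (λ j → T i j *ᶜ σ j X) ⟩
    sum (λ j → ∣ T i j *ᶜ σ j X ∣)           ≤⟨ sum-mono-≤ m (λ j → ≤-trans (≤-reflexive (∣*∣ (T i j) (σ j X)))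
                                                  (*-monoʳ-≤ 0≤∣ T i j ∣ (∣X∣≤B j))) ⟩
    sum (λ j → ∣ T i j ∣ * B)                ≈⟨ Sum.*-distribʳ-sum semiring {m} B (λ j → ∣ T i j ∣) ⟨
    sum (λ j → ∣ T i j ∣) * B                ≤⟨ *-monoˡ-≤ 0≤B (≤maximum (λ i → sum (λ j → ∣ T i j ∣)) i) ⟩
    rowNorm T * B                            ∎
    where
    solves : ∀ i → fromℤᶜ (x i) ≈ᶜ sumᶜ (λ j → T i j *ᶜ σ j X)
    solves = LinearSystem.left-inverse-solves ℂ-commutativeRing {m} {T} {λ j i → σ j (ω i)} (proj₂ T-inverse)
      {λ i → fromℤᶜ (x i)} {λ j → σ j X}
      (λ j → ℂ.trans (σ.⟦⟧-cong j X≈) (σ-homo.ℤ-combination-homo j m ω x))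

  αᶜ-integral : ∀ h i → IsIntegralᶜ (αᶜ h i)
  αᶜ-integral h i = Iᶜ.integral-resp (τ-α h i) (τ-homo.integral-homo h i α-integral)

  -- Equal to `f zero`, but written as a value of the form so that `form-splits` exhibits its
  -- conjugates as products of the -α^(hi).
  constantTerm : M.Carrier
  constantTerm = FM.form (suc n) f M.0# M.1#

  linear-0-1 : ∀ h i → linear M.0# M.1# h i ≈ᶜ -ᶜ αᶜ h i
  linear-0-1 h i = ℂ.trans (ℂ.+-cong (σ.0#-homo h) (ℂ.-‿cong (ℂ.trans (ℂ.*-congˡ (σ.1#-homo h)) (ℂ.*-identityʳ _))))
    (ℂ.+-identityˡ _)

  -- The factors -α^(hi) are integral in ℂ, while the product lies in the image of `M`. The index
  -- supplies the embedding that reflects integrality.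
  constantTerm-integral : Fin m → M.IsIntegral constantTerm
  constantTerm-integral h = σ-homo.integral-reflect h (σ-injective.injective h)
    (Iᶜ.integral-resp (ℂ.sym (form-splits h M.0# M.1#))
      (Iᶜ.product-integral (suc n) (linear M.0# M.1# h) λ i →
        Iᶜ.integral-resp (ℂ.sym (linear-0-1 h i)) (Iᶜ.neg-integral (αᶜ-integral h i))))

  ∣constantTerm∣ : ∀ h → ∣ σ h constantTerm ∣ ≈ product (λ i → ∣ αᶜ h i ∣)
  ∣constantTerm∣ h = trans (∣∣-cong (form-splits h M.0# M.1#)) (trans (∣product∣ (suc n) (linear M.0# M.1# h))
    (RingLemmas.product-cong commutativeRing (suc n) λ i → trans (∣∣-cong (linear-0-1 h i)) (∣-∣ (αᶜ h i))))

  constantTerm-size : Carrier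
  constantTerm-size = size (λ j → σ j constantTerm)

  ∣constantTerm∣≤size : ∀ j → ∣ σ j constantTerm ∣ ≤ constantTerm-size
  ∣constantTerm∣≤size = ≤maximum (λ j → ∣ σ j constantTerm ∣)

  0≤rowNorm : 0# ≤ rowNorm T
  0≤rowNorm = 0≤maximum (λ i → sum (λ j → ∣ T i j ∣))

  module _ (sizeα-small : fromℕ 2 * sizeα ≤ 1#) where

    constantTerm-small : fromℕ 2 * constantTerm-size ≤ 1#
    constantTerm-small = begin
      fromℕ 2 * constantTerm-size       ≤⟨ *-monoʳ-≤ (0≤fromℕ 2) (maximum≤ (λ h → ∣ σ h constantTerm ∣) 0≤sizeα λ h → begin
        ∣ σ h constantTerm ∣              ≈⟨ ∣constantTerm∣ h ⟩
        product (λ i → ∣ αᶜ h i ∣)        ≤⟨ product≤^ (suc n) (λ i → 0≤∣ αᶜ h i ∣) (∣αᶜ∣≤sizeα h) ⟩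
        sizeα * sizeα ^ n                ≤⟨ *-monoʳ-≤ 0≤sizeα (^-mono-≤ 0≤sizeα sizeα≤1 n) ⟩
        sizeα * 1# ^ n                   ≈⟨ trans (*-congˡ (RingLemmas.1^n≈1 commutativeRing n)) (*-identityʳ _) ⟩
        sizeα                            ∎) ⟩
      fromℕ 2 * sizeα                   ≤⟨ sizeα-small ⟩
      1#                                ∎
      where
      sizeα≤1 : sizeα ≤ 1#
      sizeα≤1 = begin
        sizeα            ≤⟨ x≤x+y 0≤sizeα ⟩
        sizeα + sizeα    ≈⟨ solve 1 (λ s → s :+ s := (con (+ 1) :+ (con (+ 1) :+ con (+ 0))) :* s) refl sizeα ⟩
        fromℕ 2 * sizeα  ≤⟨ sizeα-small ⟩
        1#               ∎

    -- The coordinates of constantTerm ^ e are integers of absolute value at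
    -- most c₂ q ^ e, where q ≤ 1/2 is the size of the constant term; if this
    -- is less than 1 they all vanish.
    constantTerm-zero : Fin m → constantTerm M.≈ M.0#
    -- `archimedean` only refutes that the constant term is nonzero; decidable equality in ℝ removes
    -- the double negation.
    constantTerm-zero h = σ-injective.injective h (∣∣≈0⇒≈0 (decidable-stable (∣ σ h constantTerm ∣ ≈? 0#)
      λ σν≉0 → archimedean 0≤q 0≤rowNorm constantTerm-small (bounded σν≉0)))
      where
      q = constantTerm-size
      0≤q = 0≤maximum (λ j → ∣ σ j constantTerm ∣)

      module _ (σν≉0 : ¬ (∣ σ h constantTerm ∣ ≈ 0#)) where
        0<∣ν∣^ : ∀ e → 0# < ∣ σ h constantTerm ∣ ^ e
        0<∣ν∣^ zero    = 0<1
        0<∣ν∣^ (suc e) = 0<x*y (0≤∧≉⇒0< 0≤∣ σ h constantTerm ∣ σν≉0) (0<∣ν∣^ e)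

        bounded : ∀ e → 1# ≤ rowNorm T * q ^ e
        bounded e = ≮⇒≥ λ <1 → νᵉ≉0 (νᵉ≈0 <1)
          where
          νᵉ = constantTerm M.^ e
          coordinates = M.IsIntegralBasis.spanning ω-basis νᵉ (IM.^-integral e (constantTerm-integral h))
          a = proj₁ coordinates

          ∣νᵉ∣ : ∀ j → ∣ σ j νᵉ ∣ ≈ ∣ σ j constantTerm ∣ ^ e
          ∣νᵉ∣ j = trans (∣∣-cong (σ-homo.^-homo j constantTerm e)) (∣^∣ (σ j constantTerm) e)

          νᵉ≉0 : ¬ (νᵉ M.≈ M.0#)
          νᵉ≉0 eq = 0<⇒≉ (0<∣ν∣^ e) (trans (sym (∣νᵉ∣ h))
            (trans (∣∣-cong (ℂ.trans (σ.⟦⟧-cong h eq) (σ.0#-homo h))) ∣0∣≈0))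

          small : rowNorm T * q ^ e < 1# → ∀ i → fromℕ ℤ.∣ a i ∣ < 1#
          small <1 i = ≤-<-trans (coordinate-bound a (proj₂ coordinates) (0≤x^n 0≤q e)
            (λ j → ≤-trans (≤-reflexive (∣νᵉ∣ j)) (^-mono-≤ 0≤∣ σ j constantTerm ∣ (∣constantTerm∣≤size j) e)) i) <1

          νᵉ≈0 : rowNorm T * q ^ e < 1# → νᵉ M.≈ M.0#
          νᵉ≈0 <1 = M.trans (proj₂ coordinates) (RingLemmas.sum-zero M.commutativeRing m _ λ i →
            M.trans (M.*-congʳ (M.reflexive (≡.cong M.fromℤ (∣∣<1⇒≡0 (a i) (small <1 i))))) (M.zeroˡ _))

  -- A vanishing conjugate forces α = 0, since τ is injective. The degree is `suc n`, so the
  -- hypothesis says that it is at least 2; then α itself is among the independent powers, and α = 0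
  -- is a nontrivial relation.
  αᶜ-nonzero : ∀ {e} → n ≡ suc e → ∀ h i → ¬ (αᶜ h i ≈ᶜ 0ᶜ)
  αᶜ-nonzero ≡.refl h i αᶜ≈0 = 1ᶜ≉0ᶜ (ℂ.trans (ℂ.sym (σ.1#-homo h))
    (ℂ.trans (σ.⟦⟧-cong h (minimal (M.1ᴹ one) α-combination≈0 one)) (σ.0#-homo h)))
    where
    one = suc zero

    α≈0 : α K.≈ K.0#
    α≈0 = τ-injective.injective h i (ℂ.trans (τ-α h i) αᶜ≈0)

    α-combination≈0 : combination (K.powers (suc n) α) (M.1ᴹ one) K.≈ K.0#
    α-combination≈0 = K.trans
      (RingLemmas.sum-cong K.commutativeRing (suc n) λ k → K.*-congʳ {K.powers (suc n) α k}
        (HomomorphismLemmas.1ᴹ-homo M.commutativeRing K.commutativeRing ι-isHom one k))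
      (K.trans (RingLemmas.1ᴹ-sum K.commutativeRing one (K.powers (suc n) α))
        (K.trans (K.*-identityʳ α) α≈0))

  1≤2*sizeα : ∀ {e} → n ≡ suc e → Fin m → 1# ≤ fromℕ 2 * sizeα
  1≤2*sizeα n≡ h = ≰⇒≥ λ ≤1 → contradiction (product≈0 ≤1) (0<⇒≉ (0<product (suc n) λ i →
          0≤∧≉⇒0< 0≤∣ αᶜ h i ∣ λ eq → αᶜ-nonzero n≡ h i (∣∣≈0⇒≈0 eq)))
    where
    product≈0 : fromℕ 2 * sizeα ≤ 1# → product (λ i → ∣ αᶜ h i ∣) ≈ 0#
    product≈0 ≤1 = trans (sym (∣constantTerm∣ h))
      (trans (∣∣-cong (ℂ.trans (σ.⟦⟧-cong h (constantTerm-zero ≤1 h)) (σ.0#-homo h))) ∣0∣≈0)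

  -- Estimates for the conjugates of β, for X and for A.

  module Estimates {μ X Y : M.Carrier}
    (β-norm : IsNorm (K.powers (suc n) α) (ι X K.- α K.* ι Y) μ)
    (c₄<∣Y∣ : Constants.c₄ αᶜ (λ j → σ j μ) T < size (λ j → σ j Y)) where

    open Constants αᶜ (λ j → σ j μ) T hiding (sizeα)

    β : K.Carrier
    β = ι X K.- α K.* ι Y

    y : Carrier
    y = size (λ j → σ j Y)

    ∣β∣ : Fin m → Vector Carrier (suc n)
    ∣β∣ h i = ∣ τ h i β ∣

    product-∣β∣ : ∀ h → product (∣β∣ h) ≈ ∣ σ h μ ∣
    product-∣β∣ h = begin-equality
      product (∣β∣ h)                       ≈⟨ RingLemmas.product-cong commutativeRing (suc n) (λ i → ∣∣-cong (τ-linear h i X Y)) ⟩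
      product (λ i → ∣ linear X Y h i ∣)    ≈⟨ ∣product∣ (suc n) (linear X Y h) ⟨
      ∣ productᶜ (linear X Y h) ∣           ≈⟨ ∣∣-cong (form-splits h X Y) ⟨
      ∣ σ h (FM.form (suc n) f X Y) ∣       ≈⟨ ∣∣-cong (σ.⟦⟧-cong h
                                               (NormForm.norm≈form M.commutativeRing K.commutativeRing ι-isHom n f-minimal β-norm)) ⟩
      ∣ σ h μ ∣                             ∎

    -- Chosen for every `h`: the final estimate takes the `h` that maximizes |Y^(h)|, but bounding
    -- all conjugates of X takes a small |β^(hi)| at each of them.
    minimizer : ∀ h → ∃ λ i → ∀ j → ∣β∣ h i ≤ ∣β∣ h j
    minimizer h = argmin n (∣β∣ h)

    minimum^≤∣μ∣ : ∀ h → ∣β∣ h (proj₁ (minimizer h)) ^ suc n ≤ ∣ σ h μ ∣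
    minimum^≤∣μ∣ h = ≤-trans (^≤product (suc n) 0≤∣ τ h (proj₁ (minimizer h)) β ∣ (proj₂ (minimizer h)))
      (≤-reflexive (product-∣β∣ h))

    0≤c₁ : 0# ≤ c₁
    0≤c₁ = 0≤maximum (λ h → maximum λ i → maximum (allExcept 0# i λ j → root (suc n) ∣ σ h μ ∣ 0≤∣ σ h μ ∣ * c h j i ⁻¹))

    0<y : 0# < y
    0<y = ≤-<-trans (≤-trans 0≤c₁ (x≤x⊔y c₁ c₃)) c₄<∣Y∣

    ∣Y∣≤y : ∀ h → ∣ σ h Y ∣ ≤ y
    ∣Y∣≤y = ≤maximum (λ j → ∣ σ j Y ∣)

    2c≈ : ∀ h j i → c h j i + c h j i ≈ ∣ αᶜ h j +ᶜ -ᶜ αᶜ h i ∣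
    2c≈ h j i = begin-equality
      half * t + half * t    ≈⟨ solve 2 (λ s t → s :* t :+ s :* t := ((con (+ 1) :+ (con (+ 1) :+ con (+ 0))) :* s) :* t) refl half t ⟩
      fromℕ 2 * half * t     ≈⟨ *-congʳ (*-inverseʳ (0<⇒≉ (0<fromℕ 1))) ⟩
      1# * t                 ≈⟨ *-identityˡ t ⟩
      t                      ∎
      where
      half = fromℕ 2 ⁻¹
      t = ∣ αᶜ h j +ᶜ -ᶜ αᶜ h i ∣

    0≤c : ∀ h j i → 0# ≤ c h j i
    0≤c h j i = *-nonNeg (0≤x⁻¹ (0<fromℕ 1)) 0≤∣ αᶜ h j +ᶜ -ᶜ αᶜ h i ∣

    0<c : ∀ h j i → j ≢ i → 0# < c h j i
    0<c h j i j≢i = 0≤∧≉⇒0< (0≤c h j i) λ c≈0 →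
      0<⇒≉ (0<∣-∣ (αᶜ h j) (αᶜ h i) λ eq → j≢i (IsRoots.distinct (αᶜ-roots h) j i eq))
        (trans (sym (2c≈ h j i)) (trans (+-cong c≈0 c≈0) (+-identityʳ 0#)))

    root≤c*y : ∀ h j i → j ≢ i → root (suc n) ∣ σ h μ ∣ 0≤∣ σ h μ ∣ ≤ c h j i * y
    root≤c*y h j i j≢i = begin
      ρ                       ≈⟨ *-identityʳ ρ ⟨
      ρ * 1#                  ≈⟨ *-congˡ (*-inverseʳ (0<⇒≉ (0<c h j i j≢i))) ⟨
      ρ * (c h j i * c h j i ⁻¹) ≈⟨ solve 3 (λ p c i → p :* (c :* i) := c :* (p :* i)) refl ρ (c h j i) (c h j i ⁻¹) ⟩
      c h j i * (ρ * c h j i ⁻¹) ≤⟨ *-monoʳ-≤ (0≤c h j i) (≤-trans ratio≤c₁ (≤-trans (x≤x⊔y c₁ c₃) (proj₁ c₄<∣Y∣))) ⟩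
      c h j i * y             ∎
      where
      ρ = root (suc n) ∣ σ h μ ∣ 0≤∣ σ h μ ∣
      ratio : Fin m → Fin (suc n) → Fin (suc n) → Carrier
      ratio h i = allExcept 0# i λ j → root (suc n) ∣ σ h μ ∣ 0≤∣ σ h μ ∣ * c h j i ⁻¹

      ratio≤c₁ : ρ * c h j i ⁻¹ ≤ c₁
      ratio≤c₁ = begin
        ρ * c h j i ⁻¹                    ≡⟨ allExcept-other 0# (λ j → root (suc n) ∣ σ h μ ∣ 0≤∣ σ h μ ∣ * c h j i ⁻¹) j≢i ⟨
        ratio h i j                       ≤⟨ ≤maximum (ratio h i) j ⟩
        maximum (ratio h i)               ≤⟨ ≤maximum (λ i → maximum (ratio h i)) i ⟩
        maximum (λ i → maximum (ratio h i)) ≤⟨ ≤maximum (λ h → maximum λ i → maximum (ratio h i)) h ⟩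
        c₁                                ∎

    -- The origin of the factor 1/2 in c_hji: the difference β^(hi) - β^(hj) has absolute value 2
    -- c_hji |Y|, and the minimal |β^(hi)| takes up at most half of it.
    c*y≤∣β∣ : ∀ h → y ≈ ∣ σ h Y ∣ → ∀ j → j ≢ proj₁ (minimizer h) → c h j (proj₁ (minimizer h)) * y ≤ ∣β∣ h j
    c*y≤∣β∣ h y≈∣Y∣ j j≢i = 0≤y-x⇒x≤y (≤-trans (x≤y⇒0≤y-x 2cy≤) (≤-reflexive
      (solve 2 (λ b t → (b :+ t) :- (t :+ t) := b :- t) refl (∣β∣ h j) (c h j i * y))))
      where
      i = proj₁ (minimizer h)

      difference : linear X Y h i +ᶜ -ᶜ linear X Y h j ≈ᶜ (αᶜ h j +ᶜ -ᶜ αᶜ h i) *ᶜ σ h Y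
      difference = ℂ.linear-difference (σ h X) (αᶜ h i) (σ h Y) (αᶜ h j)

      2cy≤ : c h j i * y + c h j i * y ≤ ∣β∣ h j + c h j i * y
      2cy≤ = begin
        c h j i * y + c h j i * y                       ≈⟨ distribʳ y _ _ ⟨
        (c h j i + c h j i) * y                         ≈⟨ *-cong (2c≈ h j i) y≈∣Y∣ ⟩
        ∣ αᶜ h j +ᶜ -ᶜ αᶜ h i ∣ * ∣ σ h Y ∣             ≈⟨ ∣*∣ (αᶜ h j +ᶜ -ᶜ αᶜ h i) (σ h Y) ⟨
        ∣ (αᶜ h j +ᶜ -ᶜ αᶜ h i) *ᶜ σ h Y ∣              ≈⟨ ∣∣-cong difference ⟨
        ∣ linear X Y h i +ᶜ -ᶜ linear X Y h j ∣         ≤⟨ ∣+∣≤ (linear X Y h i) (-ᶜ linear X Y h j) ⟩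
        ∣ linear X Y h i ∣ + ∣ -ᶜ linear X Y h j ∣      ≈⟨ +-cong (∣∣-cong (τ-linear h i X Y))
                                                             (trans (∣∣-cong (τ-linear h j X Y)) (sym (∣-∣ (linear X Y h j)))) ⟨
        ∣β∣ h i + ∣β∣ h j                               ≤⟨ +-mono-≤ (≤-trans (≤root (suc n) ∣ σ h μ ∣ 0≤∣ σ h μ ∣ 0≤∣ τ h i β ∣ (minimum^≤∣μ∣ h))
                                                             (root≤c*y h j i j≢i)) ≤-refl ⟩
        c h j i * y + ∣β∣ h j                           ≈⟨ +-comm _ _ ⟩
        ∣β∣ h j + c h j i * y                           ∎

    c-product : Fin m → Fin (suc n) → Carrier
    c-product h i = product (allExcept 1# i (λ j → c h j i))

    c-product*∣β∣≤∣μ∣ : ∀ h → y ≈ ∣ σ h Y ∣ → let i = proj₁ (minimizer h) in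
      c-product h i * y ^ n * ∣β∣ h i ≤ ∣ σ h μ ∣
    c-product*∣β∣≤∣μ∣ h y≈∣Y∣ = ≤-trans
      (allExcept-product≤product (suc n) i (λ j → c h j i) (∣β∣ h) (proj₁ 0<y) (λ j → 0≤c h j i)
        (λ j → 0≤∣ τ h j β ∣) (c*y≤∣β∣ h y≈∣Y∣))
      (≤-reflexive (product-∣β∣ h))
      where i = proj₁ (minimizer h)

    -- This is |Y| > c₃ with the denominator cleared. The hypothesis excludes |α| = 0, where `⁻¹`
    -- takes its default value 0 and c₃ carries no information.
    root-size≤ : 1# ≤ fromℕ 2 * sizeα → root (suc n) (size (λ j → σ j μ)) (0≤maximum (λ h → ∣ σ h μ ∣)) ≤ sizeα * y
    root-size≤ 1≤2sizeα = begin
      ρ                        ≈⟨ *-identityʳ ρ ⟨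
      ρ * 1#                   ≈⟨ *-congˡ (*-inverseʳ sizeα≉0) ⟨
      ρ * (sizeα * sizeα ⁻¹)   ≈⟨ solve 3 (λ p c i → p :* (c :* i) := c :* (p :* i)) refl ρ sizeα (sizeα ⁻¹) ⟩
      sizeα * (ρ * sizeα ⁻¹)   ≤⟨ *-monoʳ-≤ 0≤sizeα (≤-trans (x≤y⊔x c₁ c₃) (proj₁ c₄<∣Y∣)) ⟩
      sizeα * y                ∎
      where
      ρ = root (suc n) (size (λ j → σ j μ)) (0≤maximum (λ h → ∣ σ h μ ∣))

      sizeα≉0 : ¬ (sizeα ≈ 0#)
      sizeα≉0 eq = <⇒≱ 0<1 (≤-trans 1≤2sizeα (≤-reflexive (trans (*-congˡ eq) (zeroʳ _))))

    -- In X = β + αY, read at the minimizing index, each summand is at most |α||Y|; this is the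
    -- factor 2 of c₅.
    ∣X∣≤ : 1# ≤ fromℕ 2 * sizeα → ∀ h → ∣ σ h X ∣ ≤ fromℕ 2 * sizeα * y
    ∣X∣≤ 1≤2sizeα h = begin
      ∣ σ h X ∣                                       ≈⟨ ∣∣-cong (ℂ.x≈x-y+y (σ h X) (αᶜ h i *ᶜ σ h Y)) ⟩
      ∣ linear X Y h i +ᶜ (αᶜ h i *ᶜ σ h Y) ∣         ≤⟨ ∣+∣≤ (linear X Y h i) (αᶜ h i *ᶜ σ h Y) ⟩
      ∣ linear X Y h i ∣ + ∣ αᶜ h i *ᶜ σ h Y ∣        ≈⟨ +-cong (sym (∣∣-cong (τ-linear h i X Y))) (∣*∣ (αᶜ h i) (σ h Y)) ⟩
      ∣β∣ h i + ∣ αᶜ h i ∣ * ∣ σ h Y ∣                ≤⟨ +-mono-≤ ∣β∣≤ (*-mono-≤ 0≤sizeα 0≤∣ σ h Y ∣ (∣αᶜ∣≤sizeα h i) (∣Y∣≤y h)) ⟩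
      sizeα * y + sizeα * y                           ≈⟨ solve 2 (λ s y → s :* y :+ s :* y := (con (+ 1) :+ (con (+ 1) :+ con (+ 0))) :* s :* y) refl sizeα y ⟩
      fromℕ 2 * sizeα * y                             ∎
      where
      i = proj₁ (minimizer h)

      ∣β∣≤ : ∣β∣ h i ≤ sizeα * y
      ∣β∣≤ = ≤-trans (≤root (suc n) _ (0≤maximum (λ h → ∣ σ h μ ∣)) 0≤∣ τ h i β ∣
        (≤-trans (minimum^≤∣μ∣ h) (≤maximum (λ h → ∣ σ h μ ∣) h))) (root-size≤ 1≤2sizeα)

    module _ {xs ys : Vector ℤ m} (X≈ : X M.≈ M.ℤ-combination ω xs) (Y≈ : Y M.≈ M.ℤ-combination ω ys) where

      A : ℕ
      A = maxℕ (λ i → ℤ.∣ xs i ∣) ℕ.⊔ maxℕ (λ i → ℤ.∣ ys i ∣)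

      A≤c₅*y : 1# ≤ fromℕ 2 * sizeα → fromℕ A ≤ c₅ * y
      A≤c₅*y 1≤2sizeα = fromℕ-⊔≤ (maxℕ (λ i → ℤ.∣ xs i ∣)) (maxℕ (λ i → ℤ.∣ ys i ∣))
        (fromℕ-maxℕ≤ m (λ i → ℤ.∣ xs i ∣) 0≤c₅y λ i → ≤-trans (coordinate-bound xs X≈ 0≤B (∣X∣≤ 1≤2sizeα) i) bound)
        (fromℕ-maxℕ≤ m (λ i → ℤ.∣ ys i ∣) 0≤c₅y λ i → ≤-trans (coordinate-bound ys Y≈ 0≤B ∣Y∣≤B i) bound)
        where
        B = fromℕ 2 * sizeα * y

        0≤B : 0# ≤ B
        0≤B = *-nonNeg (*-nonNeg (0≤fromℕ 2) 0≤sizeα) (proj₁ 0<y)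

        bound : rowNorm T * B ≤ c₅ * y
        bound = ≤-reflexive (solve 4 (λ r t s y → r :* (t :* s :* y) := t :* r :* s :* y) refl (rowNorm T) (fromℕ 2) sizeα y)

        0≤c₅y : 0# ≤ c₅ * y
        0≤c₅y = ≤-trans (*-nonNeg 0≤rowNorm 0≤B) bound

        ∣Y∣≤B : ∀ j → ∣ σ j Y ∣ ≤ B
        ∣Y∣≤B j = begin
          ∣ σ j Y ∣   ≤⟨ ∣Y∣≤y j ⟩
          y           ≈⟨ *-identityˡ y ⟨
          1# * y      ≤⟨ *-monoˡ-≤ (proj₁ 0<y) 1≤2sizeα ⟩
          B           ∎

      -- Makes `fromℕ A ⁻¹` a genuine inverse. If A were 0, all coordinates of Y would vanish,
      -- against |Y| > 0.
      A≢0 : A ≢ 0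
      A≢0 A≡0 = 0<⇒≉ 0<y (antisym (maximum≤ (λ j → ∣ σ j Y ∣) ≤-refl λ j → ≤-reflexive
        (trans (∣∣-cong (ℂ.trans (σ.⟦⟧-cong j Y≈0) (σ.0#-homo j))) ∣0∣≈0)) (proj₁ 0<y))
        where
        ys≡0 : ∀ i → ys i ≡ + 0
        ys≡0 i = ℤ.∣i∣≡0⇒i≡0 (ℕ.n≤0⇒n≡0 (ℕ.≤-trans (≤maxℕ (λ i → ℤ.∣ ys i ∣) i)
          (ℕ.≤-trans (ℕ.m≤n⊔m (maxℕ (λ i → ℤ.∣ xs i ∣)) _) (ℕ.≤-reflexive A≡0))))

        Y≈0 : Y M.≈ M.0#
        Y≈0 = M.trans Y≈ (RingLemmas.sum-zero M.commutativeRing m _ λ i →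
          M.trans (M.*-congʳ (M.reflexive (≡.cong M.fromℤ (ys≡0 i)))) (M.zeroˡ _))

      0<A : 0# < fromℕ A
      0<A = positive A A≢0
        where
        positive : ∀ a → a ≢ 0 → 0# < fromℕ a
        positive zero    a≢0 = contradiction ≡.refl a≢0
        positive (suc a) _   = 0<fromℕ a

      -- In degree 1 both sides are 1, whereas 2|α| ≥ 1 fails there for α = 0. From degree 2 on,
      -- `1≤2*sizeα` gives the inequality for the bases.
      A^n≤[c₅*y]^n : Fin m → fromℕ A ^ n ≤ (c₅ * y) ^ n
      A^n≤[c₅*y]^n h = by-degree n ≡.refl
        where
        by-degree : ∀ e → n ≡ e → fromℕ A ^ e ≤ (c₅ * y) ^ e
        by-degree zero    _  = ≤-refl
        by-degree (suc e) n≡ = ^-mono-≤ (0≤fromℕ A) (A≤c₅*y (1≤2*sizeα n≡ h)) (suc e)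

      estimate : ∃₂ λ h i → ∣ τ h i β ∣ ≤ d h i * (fromℕ A ⁻¹) ^ n
      estimate = h , i , (begin
        b                                            ≈⟨ *-identityˡ b ⟨
        -- Inserting 1 as P P⁻¹ A^n A^(-n) keeps every factor nonnegative. Raising A^n to (c₅ y)^n
        -- releases the y^n that completes P y^n b, which is at most |μ^(h)|; what remains is c_hi
        -- c₅^n A^(-n).
        1# * b                                       ≈⟨ *-congʳ P*P⁻¹*A*A⁻¹≈1 ⟨
        (P * P ⁻¹) * (a ^ n * (a ⁻¹) ^ n) * b        ≈⟨ solve 5 (λ p i x j b → (p :* i) :* (x :* j) :* b := x :* (p :* i :* j :* b)) refl P (P ⁻¹) (a ^ n) ((a ⁻¹) ^ n) b ⟩
        a ^ n * (P * P ⁻¹ * (a ⁻¹) ^ n * b)          ≤⟨ *-monoˡ-≤ (*-nonNeg (*-nonNeg (*-nonNeg (proj₁ 0<P) 0≤P⁻¹) 0≤a⁻ⁿ) 0≤∣ τ h i β ∣) (A^n≤[c₅*y]^n h) ⟩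
        (c₅ * y) ^ n * (P * P ⁻¹ * (a ⁻¹) ^ n * b)   ≈⟨ *-congʳ (^-distrib-* c₅ y n) ⟩
        c₅ ^ n * y ^ n * (P * P ⁻¹ * (a ⁻¹) ^ n * b) ≈⟨ solve 6 (λ c y p i j b → c :* y :* (p :* i :* j :* b) := (p :* y :* b) :* (i :* c :* j)) refl (c₅ ^ n) (y ^ n) P (P ⁻¹) ((a ⁻¹) ^ n) b ⟩
        (P * y ^ n * b) * (P ⁻¹ * c₅ ^ n * (a ⁻¹) ^ n) ≤⟨ *-monoˡ-≤ (*-nonNeg (*-nonNeg 0≤P⁻¹ (0≤x^n 0≤c₅ n)) 0≤a⁻ⁿ) (c-product*∣β∣≤∣μ∣ h y≈∣Y∣) ⟩
        ∣ σ h μ ∣ * (P ⁻¹ * c₅ ^ n * (a ⁻¹) ^ n)     ≈⟨ solve 4 (λ u i c j → u :* (i :* c :* j) := u :* i :* c :* j) refl ∣ σ h μ ∣ (P ⁻¹) (c₅ ^ n) ((a ⁻¹) ^ n) ⟩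
        d h i * (a ⁻¹) ^ n                           ∎)
        where
        maximizer = argmax m (λ j → ∣ σ j Y ∣) 0<y
        h = proj₁ maximizer
        y≈∣Y∣ = proj₂ maximizer
        i = proj₁ (minimizer h)
        a = fromℕ A
        b = ∣β∣ h i
        P = c-product h i

        0<P : 0# < P
        0<P = 0<allExcept-product (suc n) i (λ j → c h j i) λ j → 0<c h j i

        0≤P⁻¹ = 0≤x⁻¹ 0<P
        0≤a⁻ⁿ = 0≤x^n (0≤x⁻¹ 0<A) n

        0≤c₅ : 0# ≤ c₅
        0≤c₅ = *-nonNeg (*-nonNeg (0≤fromℕ 2) 0≤rowNorm) 0≤sizeα

        P*P⁻¹*A*A⁻¹≈1 : (P * P ⁻¹) * (a ^ n * (a ⁻¹) ^ n) ≈ 1#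
        P*P⁻¹*A*A⁻¹≈1 = trans (*-cong (*-inverseʳ (0<⇒≉ 0<P)) (begin-equality
          a ^ n * (a ⁻¹) ^ n   ≈⟨ ^-distrib-* a (a ⁻¹) n ⟨
          (a * a ⁻¹) ^ n       ≈⟨ Exp.^-congˡ semiring n (*-inverseʳ (0<⇒≉ 0<A)) ⟩
          1# ^ n               ≈⟨ RingLemmas.1^n≈1 commutativeRing n ⟩
          1#                   ∎)) (*-identityˡ 1#)

theorem2 :
  ∀ {r ℓ₁ ℓ₂ ℓ₃ c ℓ₄ ℓ₅ k ℓ₆ ℓ₇}
    (ℝ : CompleteOrderedField r ℓ₁ ℓ₂ ℓ₃)
    {m n : ℕ} .{{_ : NonZero n}}
    (M : NumberField c ℓ₄ ℓ₅ m) (K : HeytingField k ℓ₆ ℓ₇) →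
  let module R = CompleteOrderedField ℝ
      module M = NumberField M
      module K = Field K
      open Reals ℝ
  in
    (ω : Vector M.Carrier m) → M.IsIntegralBasis ω →
    (ι : M.Carrier → K.Carrier) → IsHom M.rawRing K.rawRing ι →
  let open ExtensionDefs M.rawRing K.rawRing ι
  in
    (α : K.Carrier) → K.IsIntegral α →
    (f : Vector M.Carrier n) → IsMinimalPolynomial α f →
    (∀ γ → Adjoin M.heytingField K ι α γ) →
    (μ : M.Carrier) → M.IsIntegral μ → ¬ (μ M.≈ M.0#) →
    (σ : Fin m → M.Carrier → Complex) → IsEmbeddings M.rawRing σ →
    (αᶜ : Fin m → Vector Complex n) →
    (∀ j → IsRoots (λ i → σ j (f i)) (αᶜ j)) →
    (τ : Fin m → Fin n → K.Carrier → Complex) →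
    (∀ j i → IsHom K.rawRing ℂ (τ j i)) →
    (∀ j i γ → τ j i (ι γ) ≈ᶜ σ j γ) →
    (∀ j i → τ j i α ≈ᶜ αᶜ j i) →
    (S⁻¹ : Matrix Complex m) →
    RawRingDefs.IsInverse ℂ (λ j i → σ j (ω i)) S⁻¹ →
  let open Constants αᶜ (λ j → σ j μ) S⁻¹
  in
    (X Y : M.Carrier) → M.IsIntegral X → M.IsIntegral Y →
  let β = ι X K.- α K.* ι Y
  in
    IsNorm (K.powers n α) β μ →
    c₄ R.< size (λ j → σ j Y) →
    (x y : Vector ℤ m) →
    X M.≈ M.ℤ-combination ω x → Y M.≈ M.ℤ-combination ω y →
  let A = maxℕ (λ i → ℤ.∣ x i ∣) ℕ.⊔ maxℕ (λ i → ℤ.∣ y i ∣)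
  in
    ∃₂ λ h i → ∣ τ h i β ∣ R.≤ d h i R.* R.fromℕ A ^ℤ (+ 1 ℤ.- + n)
theorem2 ℝ {n = zero} {{()}}
theorem2 ℝ {n = suc n} M K ω ω-basis ι ι-isHom α α-integral f f-minimal _ μ _ _ σ σ-embeddings
  αᶜ αᶜ-roots τ τ-isHom τ-ι τ-α S⁻¹ S⁻¹-inverse X Y _ _ β-norm c₄<∣Y∣ x y X≈ Y≈ =
  h , i , R.≤-trans bound (R.≤-reflexive (R.*-congˡ (power-agrees n)))
  where
  module R = CompleteOrderedField ℝ
  open Reals ℝ
  open Conjugates ℝ M K ω-basis ι-isHom α-integral f-minimal
    (IsEmbeddings.isHom σ-embeddings) αᶜ-roots τ-isHom τ-ι τ-α S⁻¹-inverse
  open Estimates {μ} {X} {Y} β-norm c₄<∣Y∣ using (estimate)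
  result = estimate {x} {y} X≈ Y≈
  h = proj₁ result
  i = proj₁ (proj₂ result)
  bound = proj₂ (proj₂ result)

  -- For degree `suc e` the exponent 1 - (e + 1) computes to `+ 0` or to a negative integer, and in
  -- either case `_^ℤ_` unfolds to the left side.
  power-agrees : ∀ e {a} → (a ⁻¹) R.^ e R.≈ a ^ℤ (+ 1 ℤ.- + suc e)
  power-agrees zero    = R.refl
  power-agrees (suc e) = R.refl
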